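{- Let $G$ be an infinite abelian group, and let $d,H \in \mathbb{N}$ and $\vec m_1, \ldots, \vec m_H \in \mathbb{Z}^d$. Then there exist finite sets $A_1, \ldots, A_d \subseteq G$ such that, for each $1 \leq h \leq H$, the vector $$(|hA_1|, \ldots, |hA_d|)-\vec m_h \in \mathbb{Z}^d$$ is a constant vector.
   Context: $\mathbb{N}$ denotes the positive integers. For a subset $A$ of an abelian group $G$ and $h \in \mathbb{N}$, the $h$-fold iterated sumset is $hA:=\{a_1+\cdots+a_h : a_1,\ldots,a_h \in A\}$ (repetitions allowed). $|X|$ denotes the cardinality of a finite set $X$. A constant vector is a vector all of whose $d$ coordinates are equal to each other (the common value may depend on $h$). -}

module Defs where

open import Algebra.Bundles using (AbelianGroup)
open import Data.List.Base using (List; length)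
open import Data.Nat.Base using (ℕ)
open import Data.Product.Base using (∃; _×_)
open import Data.Vec.Functional using (Vector)
open import Function.Bundles using (_⇔_)
open import Level using (Level; _⊔_)
open import Relation.Binary.PropositionalEquality.Core using (_≡_)
open import Relation.Nullary.Negation.Core using (¬_)
open import Relation.Unary using (Pred; U)

IsConstant : ∀ {a} {X : Set a} {d : ℕ} → Vector X d → Set a
IsConstant v = ∀ i j → v i ≡ v j

-- The group operation is written _∙_ in the library's AbelianGroup; `sum` is
-- the iterated operation, so it is the additive sum of the mathematical text.
module Sumsets {c ℓ : Level} (G : AbelianGroup c ℓ) where

  open AbelianGroup G using (Carrier; _≈_; setoid; monoid)
  open import Algebra.Properties.Monoid.Sum monoid using (sum)
  open import Data.List.Membership.Setoid setoid using (_∈_)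
  open import Data.List.Relation.Unary.Unique.Setoid setoid using (Unique)

  -- Elements are counted up to _≈_. A predicate that has a cardinality
  -- automatically respects _≈_, because list membership does.
  HasCardinality : ∀ {p} → Pred Carrier p → ℕ → Set (c ⊔ ℓ ⊔ p)
  HasCardinality P n =
    ∃ λ (xs : List Carrier) →
      Unique xs × length xs ≡ n × (∀ x → P x ⇔ x ∈ xs)

  Finite : ∀ {p} → Pred Carrier p → Set (c ⊔ ℓ ⊔ p)
  Finite P = ∃ λ n → HasCardinality P n

  Infinite : Set (c ⊔ ℓ)
  Infinite = ¬ Finite U

  _-fold_ : ∀ {p} → ℕ → Pred Carrier p → Pred Carrier (c ⊔ ℓ ⊔ p)
  (h -fold A) x = ∃ λ (a : Vector Carrier h) → (∀ i → A (a i)) × x ≈ sum a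

{-# OPTIONS --safe #-}

-- Every A_i is a set of "generic" elements of G, up to multiples of a fixed g ≠ 0. Take the graph whose
-- vertices are cores j and leaves (t , s), in which two cores are always adjacent, two leaves never are,
-- and the leaf (t , s) is adjacent to the core j iff t < j. The set contains
--   * z_j for each core j,
--   * z_l and z_l + 2g for each leaf l, and also z_l + g if l lies in a chosen set O of leaves,
--   * z_uv + {0, g, 2g} and (z_u + z_v − z_uv) + {0, g, 2g} for nonadjacent u, v.
-- In an h-fold sum, a nonadjacent pair u, v can be replaced by the two elements attached to it, and these
-- absorb the optional z_l + g because {0, g, 2g} + {0, 2g} = {0, g, 2g} + {0, g, 2g}. So the only sums
-- affected by O are z_l + g + Σ_{j ∈ J} z_j with l ∈ O, where l and J form a clique of size h, and by
-- genericity these are new and distinct. Hence |hA| is a constant plus Σ_{(t , s) ∈ O} C(#{j > t}, h − 1),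
-- and these binomial coefficients form a unitriangular matrix.
--
-- Genericity can only be had modulo some q ≥ 2 (q = p in a vector space over the field with p elements). It
-- suffices because a clique uses each vertex once: if h atoms add up to a clique of size h, then each
-- of its vertices is accounted for by its own atom.

module Submission where

open import Defs
open import Algebra.Bundles using (AbelianGroup)
open import Axiom.ExcludedMiddle using (ExcludedMiddle)
open import Data.Empty using (⊥)
open import Data.Fin.Base as Fin using (Fin; zero; suc; toℕ; opposite)
import Data.Fin.Properties as Finₚ
open import Data.Integer.Base as ℤ using (ℤ; +_; -[1+_]; _-_)
import Data.Integer.Properties as ℤₚ
open import Data.Integer.Solver using () renaming (module +-*-Solver to ℤ-Solver)
open import Data.List.Base
  using (List; []; _∷_; _++_; map; filter; length; cartesianProduct; cartesianProductWith; upTo; allFin;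
         take; tabulate; deduplicate)
import Data.List.Membership.DecPropositional as Dec∈
open import Data.List.Membership.Propositional using (_∈_; _∉_; find)
open import Data.List.Membership.Propositional.Properties
  using (∈-∃++; ∈-++⁺ˡ; ∈-++⁺ʳ; ∈-++⁻; ∈-map⁺; ∈-map⁻; ∈-upTo⁺; ∈-allFin; ∈-cartesianProduct⁺;
         ∈-cartesianProductWith⁺; ∈-filter⁺; ∈-filter⁻)
import Data.List.Membership.Setoid as Membership
import Data.List.Membership.Setoid.Properties as ∈ₚ
open import Data.List.Properties
  using (length-++; length-map; length-filter; length-tabulate; length-take; map-∘; map-injective;
         ∷-injective; ∷-injectiveˡ; ∷-injectiveʳ)
open import Data.List.Relation.Binary.Permutation.Propositional
  using (_↭_; prep; swap; ↭-refl; ↭-sym; ↭-trans; ↭-reflexive; ↭⇒↭ₛ)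
open import Data.List.Relation.Binary.Permutation.Propositional.Properties
  using (∈-resp-↭; shift; ↭-length; drop-∷; All-resp-↭; ↭-map-inv) renaming (map⁺ to ↭-map⁺)
open import Data.List.Relation.Binary.Permutation.Setoid.Properties using (AllPairs-resp-↭)
open import Data.List.Relation.Unary.All as All using (All; []; _∷_; all?)
import Data.List.Relation.Unary.All.Properties as Allₚ
open import Data.List.Relation.Unary.AllPairs as AllPairs using (AllPairs; []; _∷_)
import Data.List.Relation.Unary.AllPairs.Properties as AllPairsₚ
open import Data.List.Relation.Unary.Any using (here; there)
open import Data.List.Relation.Unary.Unique.Propositional using (Unique)
import Data.List.Relation.Unary.Unique.DecSetoid.Properties as DecUniqueₚ
import Data.List.Relation.Unary.Unique.Propositional.Properties as Uniqueₚ
import Data.List.Relation.Unary.Unique.Setoid.Properties as SetoidUniqueₚ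
open import Data.Nat.Base
  using (ℕ; zero; suc; _+_; _*_; _∸_; _⊓_; _≤_; _<_; z≤n; s≤s; NonZero; >-nonZero; >-nonZero⁻¹; ∣_-_∣)
open import Data.Nat.Combinatorics using (_C_; nCn≡1; k>n⇒nCk≡0; nCk+nC[k+1]≡[n+1]C[k+1])
open import Data.Nat.DivMod using (_/_; _%_; m≡m%n+[m/n]*n; m%n<n; m<n⇒m%n≡m)
open import Data.Nat.Divisibility using (_∣_; _∣0; ∣m∣n⇒∣m+n; ∣m⇒∣m*n; ∣m+n∣m⇒∣n; ∣⇒≤; m%n≡0⇒n∣m)
open import Data.Nat.ListAction using (sum)
open import Data.Nat.ListAction.Properties using (sum-↭)
import Data.Nat.Properties as ℕₚ
open import Data.Nat.Solver using (module +-*-Solver)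
open import Data.Product.Base using (∃; ∃₂; _×_; _,_; proj₁; proj₂)
open import Data.Product.Function.NonDependent.Propositional using (_×-↣_)
import Data.Product.Properties as ×ₚ
open import Data.Sum.Base using (_⊎_; inj₁; inj₂)
open import Data.Sum.Function.Propositional using (_⊎-↣_)
import Data.Sum.Properties as ⊎ₚ
open import Data.Unit.Base using (⊤; tt)
import Data.Vec.Functional as Vector
open import Data.Vec.Functional using (Vector)
open import Function.Base using (_∘_; _on_; id)
open import Function.Bundles using (mk⇔; Equivalence; _↣_; Injection)
open import Function.Construct.Composition using (_↣-∘_)
open import Function.Construct.Identity using (↣-id)
open import Function.Properties.Inverse using (↔⇒↣; ↔-sym)
open import Level using (Level; _⊔_; Lift; lift; lower)
open import Relation.Binary.Bundles using (Setoid; DecSetoid)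
open import Relation.Binary.Core using (Rel)
open import Relation.Binary.Definitions using (DecidableEquality; Symmetric)
open import Relation.Binary.PropositionalEquality as ≡ using (_≡_; _≢_)
open import Relation.Nullary.Decidable using (Dec; yes; no; map′; ¬?; _×-dec_)
open import Relation.Nullary.Negation using (¬_; contradiction)
open import Relation.Unary using (Pred)

open import Algebra.Properties.CommutativeMonoid.Sum ℤₚ.+-0-commutativeMonoid
  using (sum-cong-≋; sum-replicate-zero; ∑-distrib-+) renaming (sum to ∑ℤ)

private variable
  α β ρ : Level
  A : Set α
  B : Set β
  xs ys : List A

-- Duplicate-free lists up to permutation.

∈⇒∷↭ : ∀ {x : A} → x ∈ xs → ∃ λ ys → xs ↭ x ∷ ys
∈⇒∷↭ {x = x} x∈xs with ys , zs , ≡.refl ← ∈-∃++ x∈xs = ys ++ zs , shift x ys zs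

AllPairs-↭ : {R : Rel A ρ} → Symmetric R → AllPairs R xs → xs ↭ ys → AllPairs R ys
AllPairs-↭ R-sym ps p = AllPairs-resp-↭ (≡.setoid _) R-sym ((λ { ≡.refl r → r }) , (λ { ≡.refl r → r }))
  (↭⇒↭ₛ p) ps

AllPairs-lookup : ∀ {R : Rel A ρ} {x y} → AllPairs R xs → x ∈ xs → y ∈ xs → x ≢ y → R x y ⊎ R y x
AllPairs-lookup (rs ∷ _)  (here ≡.refl) (here ≡.refl) x≢y = contradiction ≡.refl x≢y
AllPairs-lookup (rs ∷ _)  (here ≡.refl) (there y∈)  _   = inj₁ (All.lookup rs y∈)
AllPairs-lookup (rs ∷ _)  (there x∈)  (here ≡.refl) _   = inj₂ (All.lookup rs x∈)
AllPairs-lookup (_ ∷ rss) (there x∈)  (there y∈)  x≢y = AllPairs-lookup rss x∈ y∈ x≢y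

-- Pigeonhole: each entry of `xs` uses up a different entry of `ys`, and since `ys` is no longer
-- than `xs`, nothing is left over.
Unique-⊆-length⇒↭ : Unique xs → (∀ {x} → x ∈ xs → x ∈ ys) → length ys ≤ length xs → ys ↭ xs
Unique-⊆-length⇒↭ {ys = []}     []            sub len = ↭-refl
Unique-⊆-length⇒↭ {ys = _ ∷ _}  []            sub ()
Unique-⊆-length⇒↭ {xs = x ∷ xs} (x∉xs ∷ uniq) sub len
  with zs , p ← ∈⇒∷↭ (sub (here ≡.refl)) =
  ↭-trans p (prep x (Unique-⊆-length⇒↭ uniq sub′
    (ℕₚ.≤-pred (≡.subst (_≤ suc (length xs)) (↭-length p) len))))
  where
  sub′ : ∀ {y} → y ∈ xs → y ∈ zs
  sub′ y∈xs with ∈-resp-↭ p (sub (there y∈xs))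
  ... | here ≡.refl  = contradiction ≡.refl (All.lookup x∉xs y∈xs)
  ... | there y∈zs = y∈zs

module _ {c ℓ} (S : Setoid c ℓ) where
  open Setoid S using (_≈_; Carrier)

  map-unique⁺ : {f : A → Carrier} →
    Unique xs → (∀ {x y} → x ∈ xs → y ∈ xs → f x ≈ f y → x ≡ y) →
    AllPairs (λ u v → ¬ u ≈ v) (map f xs)
  map-unique⁺ []            inj = []
  map-unique⁺ (x∉xs ∷ uniq) inj =
    Allₚ.map⁺ (All.tabulate λ y∈ fx≈fy →
      All.lookup x∉xs y∈ (inj (here ≡.refl) (there y∈) fx≈fy))
    ∷ map-unique⁺ uniq (λ x∈ y∈ → inj (there x∈) (there y∈))

-- Dependent products of lists

Σ[_] : List A → (A → ℕ) → ℕ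
Σ[ xs ] f = sum (map f xs)

dprod : List A → (A → List B) → List (A × B)
dprod []       f = []
dprod (x ∷ xs) f = map (x ,_) (f x) ++ dprod xs f

∈-dprod⁺ : (f : A → List B) {u : A} {v : B} → u ∈ xs → v ∈ f u → (u , v) ∈ dprod xs f
∈-dprod⁺ f (here ≡.refl) v∈ = ∈-++⁺ˡ (∈-map⁺ (_ ,_) v∈)
∈-dprod⁺ f (there u∈)  v∈ = ∈-++⁺ʳ _ (∈-dprod⁺ f u∈ v∈)

∈-dprod⁻ : ∀ xs (f : A → List B) {u : A} {v : B} → (u , v) ∈ dprod xs f → u ∈ xs × v ∈ f u
∈-dprod⁻ (x ∷ xs) f uv∈ with ∈-++⁻ (map (x ,_) (f x)) uv∈
... | inj₁ uv∈₁ with _ , v∈ , ≡.refl ← ∈-map⁻ (x ,_) uv∈₁ = here ≡.refl , v∈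
... | inj₂ uv∈₂ with u∈ , v∈ ← ∈-dprod⁻ xs f uv∈₂ = there u∈ , v∈

dprod-unique : (f : A → List B) → Unique xs → (∀ {x} → x ∈ xs → Unique (f x)) → Unique (dprod xs f)
dprod-unique f [] funiq = []
dprod-unique {xs = x ∷ xs} f (x∉xs ∷ uniq) funiq = Uniqueₚ.++⁺
  (Uniqueₚ.map⁺ (λ { ≡.refl → ≡.refl }) (funiq (here ≡.refl)))
  (dprod-unique f uniq (funiq ∘ there))
  λ { (p , q) → disjoint p q }
  where
  disjoint : ∀ {p} → p ∈ map (x ,_) (f x) → p ∈ dprod xs f → _
  disjoint p∈ q∈ with _ , _ , ≡.refl ← ∈-map⁻ (x ,_) p∈ =
    All.lookup x∉xs (proj₁ (∈-dprod⁻ xs f q∈)) ≡.refl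

length-dprod : ∀ xs (f : A → List B) → length (dprod xs f) ≡ Σ[ xs ] (length ∘ f)
length-dprod []       f = ≡.refl
length-dprod (x ∷ xs) f = ≡.trans (length-++ (map (x ,_) (f x)))
  (≡.cong₂ _+_ (length-map (x ,_) (f x)) (length-dprod xs f))

Σ-dprod : ∀ xs (f : A → List B) (φ : A → ℕ) →
  Σ[ dprod xs f ] (φ ∘ proj₁) ≡ Σ[ xs ] (λ x → length (f x) * φ x)
Σ-dprod []       f φ = ≡.refl
Σ-dprod (x ∷ xs) f φ = go (f x)
  where
  go : ∀ bs → Σ[ map (x ,_) bs ++ dprod xs f ] (φ ∘ proj₁) ≡
              length bs * φ x + Σ[ xs ] (λ x → length (f x) * φ x)
  go []       = Σ-dprod xs f φ
  go (b ∷ bs) = ≡.trans (≡.cong (λ s → φ x + s) (go bs)) (≡.sym (ℕₚ.+-assoc (φ x) _ _))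

-- Sublists of a given length

sublists : ℕ → List A → List (List A)
sublists zero    xs       = [] ∷ []
sublists (suc k) []       = []
sublists (suc k) (x ∷ xs) = map (x ∷_) (sublists k xs) ++ sublists (suc k) xs

length-sublists : ∀ k (xs : List A) → length (sublists k xs) ≡ length xs C k
length-sublists zero    xs       = ≡.sym (nC0≡1 (length xs))
  where
  nC0≡1 : ∀ n → n C 0 ≡ 1
  nC0≡1 n = ≡.refl
length-sublists (suc k) []       = ≡.refl
length-sublists (suc k) (x ∷ xs) = begin
  length (map (x ∷_) (sublists k xs) ++ sublists (suc k) xs)
    ≡⟨ length-++ (map (x ∷_) (sublists k xs)) ⟩
  length (map (x ∷_) (sublists k xs)) + length (sublists (suc k) xs)
    ≡⟨ ≡.cong (_+ _) (length-map (x ∷_) (sublists k xs)) ⟩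
  length (sublists k xs) + length (sublists (suc k) xs)
    ≡⟨ ≡.cong₂ _+_ (length-sublists k xs) (length-sublists (suc k) xs) ⟩
  length xs C k + length xs C suc k
    ≡⟨ nCk+nC[k+1]≡[n+1]C[k+1] (length xs) k ⟩
  suc (length xs) C suc k ∎
  where open ≡.≡-Reasoning

∈-sublists⇒⊆ : ∀ k (xs : List A) {y} → ys ∈ sublists k xs → y ∈ ys → y ∈ xs
∈-sublists⇒⊆ zero    xs       (here ≡.refl) ()
∈-sublists⇒⊆ (suc k) (x ∷ xs) ys∈ y∈ with ∈-++⁻ (map (x ∷_) (sublists k xs)) ys∈
... | inj₂ ys∈₂ = there (∈-sublists⇒⊆ (suc k) xs ys∈₂ y∈)
... | inj₁ ys∈₁ with _ , zs∈ , ≡.refl ← ∈-map⁻ (x ∷_) ys∈₁ with y∈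
...   | here ≡.refl = here ≡.refl
...   | there y∈₁ = there (∈-sublists⇒⊆ k xs zs∈ y∈₁)

∈-sublists⇒length : ∀ k (xs : List A) → ys ∈ sublists k xs → length ys ≡ k
∈-sublists⇒length zero    xs       (here ≡.refl) = ≡.refl
∈-sublists⇒length (suc k) (x ∷ xs) ys∈ with ∈-++⁻ (map (x ∷_) (sublists k xs)) ys∈
... | inj₂ ys∈₂ = ∈-sublists⇒length (suc k) xs ys∈₂
... | inj₁ ys∈₁ with _ , zs∈ , ≡.refl ← ∈-map⁻ (x ∷_) ys∈₁ = ≡.cong suc (∈-sublists⇒length k xs zs∈)

∈-sublists⇒Unique : ∀ k {xs : List A} → Unique xs → ys ∈ sublists k xs → Unique ys
∈-sublists⇒Unique zero    uniq (here ≡.refl) = []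
∈-sublists⇒Unique (suc k) {x ∷ xs} (x∉xs ∷ uniq) ys∈ with ∈-++⁻ (map (x ∷_) (sublists k xs)) ys∈
... | inj₂ ys∈₂ = ∈-sublists⇒Unique (suc k) uniq ys∈₂
... | inj₁ ys∈₁ with _ , zs∈ , ≡.refl ← ∈-map⁻ (x ∷_) ys∈₁ =
  All.tabulate (λ y∈ → All.lookup x∉xs (∈-sublists⇒⊆ k xs zs∈ y∈)) ∷ ∈-sublists⇒Unique k uniq zs∈

sublists-∷⁺ : ∀ {x : A} k → ys ∈ sublists k xs → ys ∈ sublists k (x ∷ xs)
sublists-∷⁺                  zero    (here ≡.refl) = here ≡.refl
sublists-∷⁺ {xs = xs} {x} (suc k) ys∈        = ∈-++⁺ʳ (map (x ∷_) (sublists k xs)) ys∈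

sublists-unique : ∀ k {xs : List A} → Unique xs → Unique (sublists k xs)
sublists-unique zero    uniq = [] ∷ []
sublists-unique (suc k) {[]}     uniq = []
sublists-unique (suc k) {x ∷ xs} (x∉xs ∷ uniq) = Uniqueₚ.++⁺
  (Uniqueₚ.map⁺ (λ { ≡.refl → ≡.refl }) (sublists-unique k uniq))
  (sublists-unique (suc k) uniq)
  λ { (p , q) → disjoint p q }
  where
  disjoint : ∀ {ys} → ys ∈ map (x ∷_) (sublists k xs) → ys ∈ sublists (suc k) xs → _
  disjoint p q with _ , _ , ≡.refl ← ∈-map⁻ (x ∷_) p =
    All.lookup x∉xs (∈-sublists⇒⊆ (suc k) xs q (here ≡.refl)) ≡.refl

-- Sublists keep the order of `xs`, so each subset of a duplicate-free list has a single
-- representative: the head of `xs` lies in both lists or in neither, which reduces the comparison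
-- to the tail of `xs`.
sublists-↭⇒≡ : ∀ k {xs ys zs : List A} → Unique xs →
  ys ∈ sublists k xs → zs ∈ sublists k xs → ys ↭ zs → ys ≡ zs
sublists-↭⇒≡ zero uniq (here ≡.refl) (here ≡.refl) p = ≡.refl
sublists-↭⇒≡ (suc k) {x ∷ xs} (x∉xs ∷ uniq) ys∈ zs∈ p
  with ∈-++⁻ (map (x ∷_) (sublists k xs)) ys∈ | ∈-++⁻ (map (x ∷_) (sublists k xs)) zs∈
... | inj₂ ys∈₂ | inj₂ zs∈₂ = sublists-↭⇒≡ (suc k) uniq ys∈₂ zs∈₂ p
... | inj₁ ys∈₁ | inj₂ zs∈₂ with _ , _ , ≡.refl ← ∈-map⁻ (x ∷_) ys∈₁ =
  contradiction ≡.refl (All.lookup x∉xs (∈-sublists⇒⊆ (suc k) xs zs∈₂ (∈-resp-↭ p (here ≡.refl))))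
... | inj₂ ys∈₂ | inj₁ zs∈₁ with _ , _ , ≡.refl ← ∈-map⁻ (x ∷_) zs∈₁ =
  contradiction ≡.refl (All.lookup x∉xs (∈-sublists⇒⊆ (suc k) xs ys∈₂ (∈-resp-↭ (↭-sym p) (here ≡.refl))))
... | inj₁ ys∈₁ | inj₁ zs∈₁
  with _ , us∈ , ≡.refl ← ∈-map⁻ (x ∷_) ys∈₁ | _ , vs∈ , ≡.refl ← ∈-map⁻ (x ∷_) zs∈₁ =
  ≡.cong (x ∷_) (sublists-↭⇒≡ k uniq us∈ vs∈ (drop-∷ p))

-- Sublists and multiplicities under decidable equality.

module _ {A : Set α} (_≟_ : DecidableEquality A) where

  open import Data.List.Membership.DecPropositional _≟_ using (_∈?_)

  -- Sorts `ys` into the order of `xs`: the head of `xs` is skipped if `ys` lacks it, and is moved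
  -- to the front otherwise.
  ⊆-unique⇒sublist : ∀ {xs ys : List A} → Unique ys → (∀ {y} → y ∈ ys → y ∈ xs) →
    ∃ λ zs → zs ∈ sublists (length ys) xs × ys ↭ zs
  ⊆-unique⇒sublist {[]} {[]}     uniq sub = [] , here ≡.refl , ↭-refl
  ⊆-unique⇒sublist {[]} {y ∷ ys} uniq sub with () ← sub (here ≡.refl)
  ⊆-unique⇒sublist {x ∷ xs} {ys} uniq sub with x ∈? ys
  ... | no x∉ys = zs , sublists-∷⁺ (length ys) zs∈ , p
    where
    sub′ : ∀ {y} → y ∈ ys → y ∈ xs
    sub′ y∈ with sub y∈
    ... | here ≡.refl = contradiction y∈ x∉ys
    ... | there y∈₁ = y∈₁
    ih = ⊆-unique⇒sublist uniq sub′
    zs = proj₁ ih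
    zs∈ = proj₁ (proj₂ ih)
    p = proj₂ (proj₂ ih)
  ... | yes x∈ys with us , p ← ∈⇒∷↭ x∈ys
    with x∉us ∷ uniqus ← AllPairs-↭ (λ u≢v v≡u → u≢v (≡.sym v≡u)) uniq p =
    x ∷ zs
    , ≡.subst (λ k → x ∷ zs ∈ sublists k (x ∷ xs)) (≡.sym (↭-length p)) (∈-++⁺ˡ (∈-map⁺ (x ∷_) zs∈))
    , ↭-trans p (prep x p′)
    where
    sub′ : ∀ {y} → y ∈ us → y ∈ xs
    sub′ y∈ with sub (∈-resp-↭ (↭-sym p) (there y∈))
    ... | here ≡.refl = contradiction ≡.refl (All.lookup x∉us y∈)
    ... | there y∈₁ = y∈₁
    ih = ⊆-unique⇒sublist uniqus sub′
    zs = proj₁ ih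
    zs∈ = proj₁ (proj₂ ih)
    p′ = proj₂ (proj₂ ih)

  δ : A → A → ℕ
  δ x y with x ≟ y
  ... | yes _ = 1
  ... | no  _ = 0

  δ-refl : ∀ x → δ x x ≡ 1
  δ-refl x with x ≟ x
  ... | yes _  = ≡.refl
  ... | no x≢x = contradiction ≡.refl x≢x

  δ-≢ : ∀ {x y} → x ≢ y → δ x y ≡ 0
  δ-≢ {x} {y} x≢y with x ≟ y
  ... | yes x≡y = contradiction x≡y x≢y
  ... | no _    = ≡.refl

  count : A → List A → ℕ
  count x xs = Σ[ xs ] (δ x)

  count-∉ : ∀ {x} xs → x ∉ xs → count x xs ≡ 0
  count-∉ []       x∉ = ≡.refl
  count-∉ (y ∷ xs) x∉ = ≡.cong₂ _+_ (δ-≢ (x∉ ∘ here)) (count-∉ xs (x∉ ∘ there))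

  count-Unique : ∀ {x xs} → Unique xs → x ∈ xs → count x xs ≡ 1
  count-Unique {x} (x∉ ∷ _)    (here ≡.refl) =
    ≡.cong₂ _+_ (δ-refl x) (count-∉ _ (λ x∈ → All.lookup x∉ x∈ ≡.refl))
  count-Unique {x} (y∉ ∷ uniq) (there x∈)  =
    ≡.cong₂ _+_ (δ-≢ (λ { ≡.refl → All.lookup y∉ x∈ ≡.refl })) (count-Unique uniq x∈)

  private
    remove : A → List A → List A
    remove x = filter (¬? ∘ (x ≟_))

    Σ-remove : ∀ x (f : A → ℕ) xs → Σ[ xs ] f ≡ count x xs * f x + Σ[ remove x xs ] f
    Σ-remove x f []       = ≡.refl
    Σ-remove x f (y ∷ xs) with x ≟ y
    ... | yes ≡.refl = ≡.trans (≡.cong (λ s → f x + s) (Σ-remove x f xs)) (≡.sym (ℕₚ.+-assoc (f x) _ _))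
    ... | no  _    = ≡.trans (≡.cong (λ s → f y + s) (Σ-remove x f xs)) (swap₃ (f y) (count x xs * f x) _)
      where
      swap₃ : ∀ i j k → i + (j + k) ≡ j + (i + k)
      swap₃ = solve 3 (λ i j k → i :+ (j :+ k) := j :+ (i :+ k)) ≡.refl
        where open +-*-Solver

    count-remove : ∀ {x y} xs → x ≢ y → count y (remove x xs) ≡ count y xs
    count-remove {x} {y} xs x≢y = ≡.sym (≡.trans (Σ-remove x (δ y) xs)
      (≡.cong (_+ Σ[ remove x xs ] (δ y)) 
        (≡.trans (≡.cong (count x xs *_) (δ-≢ (x≢y ∘ ≡.sym))) (ℕₚ.*-zeroʳ (count x xs)))))

    count-remove-self : ∀ x xs → count x (remove x xs) ≡ 0
    count-remove-self x xs = count-∉ _ (λ x∈ → All.lookup (Allₚ.all-filter (¬? ∘ (x ≟_)) xs) x∈ ≡.refl)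

  -- Collecting equal entries turns the sum into terms `count x xs * f x` over distinct `x`, each
  -- divisible by `q`. The recursion runs on a length bound because all copies of an entry are
  -- removed at once.
  ∣-Σ : ∀ q (f : A → ℕ) xs → (∀ x → f x ≡ 0 ⊎ q ∣ count x xs) → q ∣ Σ[ xs ] f
  ∣-Σ q f xs = go (length xs) xs ℕₚ.≤-refl
    where
    go : ∀ n xs → length xs ≤ n → (∀ x → f x ≡ 0 ⊎ q ∣ count x xs) → q ∣ Σ[ xs ] f
    go n       []          _         h = q ∣0
    go (suc n) (x ∷ xs) (s≤s len) h =
      ≡.subst (q ∣_) (≡.sym (Σ-remove x f (x ∷ xs)))
        (∣m∣n⇒∣m+n (head (h x)) (go n (remove x (x ∷ xs)) len′ h′))
      where
      head : f x ≡ 0 ⊎ q ∣ count x (x ∷ xs) → q ∣ count x (x ∷ xs) * f x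
      head (inj₁ fx≡0) = ≡.subst (q ∣_) (≡.sym (≡.trans (≡.cong (count x (x ∷ xs) *_) fx≡0)
                                                      (ℕₚ.*-zeroʳ (count x (x ∷ xs))))) (q ∣0)
      head (inj₂ q∣c)  = ∣m⇒∣m*n (f x) q∣c
      len′ : length (remove x (x ∷ xs)) ≤ n
      len′ with x ≟ x
      ... | yes _  = ℕₚ.≤-trans (length-filter _ xs) len
      ... | no x≢x = contradiction ≡.refl x≢x
      h′ : ∀ y → f y ≡ 0 ⊎ q ∣ count y (remove x (x ∷ xs))
      h′ y with h y | x ≟ y
      ... | inj₁ fy≡0 | _        = inj₁ fy≡0
      ... | inj₂ q∣c  | yes ≡.refl = inj₂ (≡.subst (q ∣_) (≡.sym (count-remove-self x (x ∷ xs))) (q ∣0))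
      ... | inj₂ q∣c  | no x≢y   = inj₂ (≡.subst (q ∣_) (≡.sym (count-remove (x ∷ xs) x≢y)) q∣c)

-- Excluded middle at lower levels and enumeration of short lists.

lowerEM : ∀ {p} o → ExcludedMiddle (p ⊔ o) → ExcludedMiddle p
lowerEM o em {P} = map′ lower lift (em {Lift o P})

-- Supplies the finite search spaces: the combinations that a new generic element has to avoid, and
-- the candidates for `h`-fold sums.
boundedLists : ∀ {a} {A : Set a} → List A → ℕ → List (List A)
boundedLists xs zero    = [] ∷ []
boundedLists xs (suc n) = [] ∷ cartesianProductWith _∷_ xs (boundedLists xs n)

∈-boundedLists : ∀ {a} {A : Set a} {xs : List A} → (∀ x → x ∈ xs) →
  ∀ {n} l → length l ≤ n → l ∈ boundedLists xs n
∈-boundedLists all {zero}  []      _         = here ≡.refl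
∈-boundedLists all {suc n} []      _         = here ≡.refl
∈-boundedLists all {suc n} (x ∷ l) (s≤s len) =
  there (∈-cartesianProductWith⁺ _∷_ (all x) (∈-boundedLists all l len))

-- Finiteness in an abelian group, treated classically.

module GenericElements {c ℓ : Level} (em : ExcludedMiddle (c ⊔ ℓ)) (G : AbelianGroup c ℓ) where

  open AbelianGroup G
  open Sumsets G
  open Membership setoid using () renaming (_∈_ to _∈ᵍ_; _∉_ to _∉ᵍ_)
  open import Algebra.Properties.Group group using (∙-cancelˡ)
  open import Algebra.Properties.CommutativeMonoid.Mult commutativeMonoid public
    using () renaming (_×_ to _·_; ×-congʳ to ·-congʳ; ×-congˡ to ·-congˡ; ×-homo-+ to ·-homo-+;
                       ×-assocˡ to ·-assocˡ; ×-distrib-+ to ·-distrib-∙)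
  open import Algebra.Properties.CommutativeSemigroup commutativeSemigroup using (x∙yz≈y∙xz)
  open import Relation.Binary.Reasoning.Setoid setoid

  -- A form of finiteness that only bounds `P` from above: `ys` may have repetitions and elements
  -- outside `P`.
  Covered : ∀ {p} → Pred Carrier p → Set (c ⊔ ℓ ⊔ p)
  Covered P = ∃ λ (ys : List Carrier) → ∀ {x} → P x → x ∈ᵍ ys

  decSetoid : DecSetoid c ℓ
  decSetoid = record
    { isDecEquivalence = record { isEquivalence = isEquivalence ; _≟_ = λ x y → lowerEM c em } }

  open DecSetoid decSetoid using () renaming (_≟_ to _≈?_)

  dedup-hasCardinality : ∀ {p} {P : Pred Carrier p} ys → (∀ x → P x → x ∈ᵍ ys) → (∀ x → x ∈ᵍ ys → P x) →
    HasCardinality P (length (deduplicate _≈?_ ys))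
  dedup-hasCardinality ys P⇒∈ ∈⇒P =
    deduplicate _≈?_ ys , DecUniqueₚ.deduplicate-! decSetoid ys , ≡.refl ,
    λ x → mk⇔ (∈ₚ.∈-deduplicate⁺ setoid _≈?_ (λ z≈y x≈y → trans x≈y (sym z≈y)) ∘ P⇒∈ x)
              (∈⇒P x ∘ ∈ₚ.∈-deduplicate⁻ setoid _≈?_ ys)

  infinite⇒¬covered : Infinite → ¬ Covered {ℓ} (λ _ → Lift ℓ ⊤)
  infinite⇒¬covered inf (ys , all) = inf (_ , dedup-hasCardinality ys (λ _ _ → all _) (λ _ _ → _))

  -- Infinitude is only a negation, so the witness comes from excluded middle: without one, `ys`
  -- would cover `P`.
  fresh : ∀ {P : Pred Carrier ℓ} → ¬ Covered P → ∀ ys → ∃ λ x → P x × x ∉ᵍ ys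
  fresh {P} ¬cov ys with em {∃ λ x → P x × x ∉ᵍ ys}
  ... | yes found = found
  ... | no ¬found = contradiction (ys , λ {x} → inYs x) ¬cov
    where
    inYs : ∀ x → P x → x ∈ᵍ ys
    inYs x Px with em {x ∈ᵍ ys}
    ... | yes x∈ = x∈
    ... | no x∉  = contradiction (x , Px , x∉) ¬found

  -- Torsion and the choice of the modulus.

  Torsion : ℕ → Pred Carrier ℓ
  Torsion q x = q · x ≈ ε

  ·-zeroʳ : ∀ n → n · ε ≈ ε
  ·-zeroʳ zero    = refl
  ·-zeroʳ (suc n) = trans (identityˡ _) (·-zeroʳ n)

  -- The solutions, if there are any, form a coset of the `n`-torsion, so translating a cover of the
  -- torsion by one solution covers them.
  preimage-covered : ∀ n → Covered (Torsion n) → ∀ y → Covered (λ x → n · x ≈ y)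
  preimage-covered n (ts , t∈) y with em {∃ λ x → n · x ≈ y}
  ... | no ¬sol = [] , λ nx≈y → contradiction (_ , nx≈y) ¬sol
  ... | yes (x₀ , nx₀≈y) = map (x₀ ∙_) ts , λ {x} nx≈y →
    ∈ₚ.∈-resp-≈ setoid (x₀∙x₀⁻¹x≈x x) (∈ₚ.∈-map⁺ setoid setoid ∙-congˡ (t∈ (torsion nx≈y)))
    where
    x₀∙x₀⁻¹x≈x : ∀ x → x₀ ∙ (x₀ ⁻¹ ∙ x) ≈ x
    x₀∙x₀⁻¹x≈x x = trans (sym (assoc _ _ _)) (trans (∙-congʳ (inverseʳ x₀)) (identityˡ x))
    torsion : ∀ {x} → n · x ≈ y → n · (x₀ ⁻¹ ∙ x) ≈ ε
    torsion {x} nx≈y = ∙-cancelˡ (n · x₀) _ _ (begin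
      n · x₀ ∙ n · (x₀ ⁻¹ ∙ x)  ≈⟨ ·-distrib-∙ x₀ (x₀ ⁻¹ ∙ x) n ⟨
      n · (x₀ ∙ (x₀ ⁻¹ ∙ x))    ≈⟨ ·-congʳ n (x₀∙x₀⁻¹x≈x x) ⟩
      n · x                     ≈⟨ trans nx≈y (sym nx₀≈y) ⟩
      n · x₀                    ≈⟨ identityʳ _ ⟨
      n · x₀ ∙ ε                ∎)

  preimages-covered : ∀ n → Covered (Torsion n) → ∀ ys → Covered (λ x → n · x ∈ᵍ ys)
  preimages-covered n cov []       = [] , λ ()
  preimages-covered n cov (y ∷ ys)
    with us , u∈ ← preimage-covered n cov y | vs , v∈ ← preimages-covered n cov ys =
    us ++ vs , λ { (here nx≈y)  → ∈ₚ.∈-++⁺ˡ setoid (u∈ nx≈y)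
                 ; (there nx∈) → ∈ₚ.∈-++⁺ʳ setoid us (v∈ nx∈) }

  SmallTorsionCovered : ℕ → Set (c ⊔ ℓ)
  SmallTorsionCovered q = ∀ n → 0 < n → n < q → Covered (Torsion n)

  smallMultiples-covered : ∀ q → SmallTorsionCovered q → ∀ ys →
    Covered (λ x → ∃ λ n → 0 < n × n < q × n · x ∈ᵍ ys)
  smallMultiples-covered zero    small ys = [] , λ { (_ , _ , () , _) }
  smallMultiples-covered (suc zero) small ys = [] , λ { (suc _ , _ , s≤s () , _) }
  smallMultiples-covered (suc q@(suc _)) small ys
    with us , u∈ ← smallMultiples-covered q (λ n 0<n n<q → small n 0<n (ℕₚ.m<n⇒m<1+n n<q)) ys
       | vs , v∈ ← preimages-covered q (small q (s≤s z≤n) ℕₚ.≤-refl) ys =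
    us ++ vs , λ {x} (n , 0<n , n<1+q , nx∈) → case n 0<n n<1+q nx∈
    where
    case : ∀ n {x} → 0 < n → n < suc q → n · x ∈ᵍ ys → x ∈ᵍ us ++ vs
    case n 0<n (s≤s n≤q) nx∈ with ℕₚ.m≤n⇒m<n∨m≡n n≤q
    ... | inj₁ n<q    = ∈ₚ.∈-++⁺ˡ setoid (u∈ (n , 0<n , n<q , nx∈))
    ... | inj₂ ≡.refl = ∈ₚ.∈-++⁺ʳ setoid us (v∈ nx∈)

  private
    -- Searches for the least positive `q ≤ m` with infinite `q`-torsion. Minimality is what makes
    -- all smaller torsion finite.
    firstLargeTorsion : ∀ m →
      (∃ λ q → 0 < q × q ≤ m × ¬ Covered (Torsion q) × SmallTorsionCovered q) ⊎ SmallTorsionCovered (suc m)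
    firstLargeTorsion zero    = inj₂ λ { (suc _) _ (s≤s ()) }
    firstLargeTorsion (suc m) with firstLargeTorsion m
    ... | inj₁ (q , 0<q , q≤m , rest) = inj₁ (q , 0<q , ℕₚ.m≤n⇒m≤1+n q≤m , rest)
    ... | inj₂ small with em {Covered (Torsion (suc m))}
    ...   | no ¬cov = inj₁ (suc m , s≤s z≤n , ℕₚ.≤-refl , ¬cov , small)
    ...   | yes cov = inj₂ λ n 0<n → λ { (s≤s n≤1+m) → case n 0<n n≤1+m }
      where
      case : ∀ n → 0 < n → n ≤ suc m → Covered (Torsion n)
      case n 0<n n≤1+m with ℕₚ.m≤n⇒m<n∨m≡n n≤1+m
      ... | inj₁ n<1+m  = small n 0<n n<1+m
      ... | inj₂ ≡.refl = cov

  -- The torsion condition is vacuous when no multiple q ≤ m annihilates infinitely many elements.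
  genericModulus : Infinite → ∀ m → 1 ≤ m →
    ∃ λ q → 2 ≤ q × ¬ Covered (λ x → Lift ℓ (q ≤ m) → Torsion q x) × SmallTorsionCovered q
  genericModulus inf m 1≤m with firstLargeTorsion m
  -- Here `q = m + 1` exceeds every multiplicity in a list of length at most `m`, so congruence
  -- modulo `q` of such multiplicities is equality.
  ... | inj₂ small = suc m , s≤s 1≤m
    , (λ { (ys , all) → infinite⇒¬covered inf
        (ys , λ _ → all λ { (lift 1+m≤m) → contradiction 1+m≤m (ℕₚ.<-irrefl ≡.refl) }) })
    , small
  -- The 1-torsion is trivial, hence covered; this is why the modulus is at least 2.
  ... | inj₁ (suc zero , _ , _ , ¬cov , _) =
    contradiction (ε ∷ [] , λ {x} (1x≈ε : Torsion 1 x) → here (trans (sym (identityʳ _)) 1x≈ε)) ¬cov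
  ... | inj₁ (q@(suc (suc _)) , _ , q≤m , ¬cov , small) = q , s≤s (s≤s z≤n)
    , (λ { (ys , all) → ¬cov (ys , λ qx≈ε → all (λ _ → qx≈ε)) }) , small

  -- Existence of generic families.

  Σᵍ : ∀ {i} {I : Set i} → (I → Carrier) → List I → Carrier
  Σᵍ z []      = ε
  Σᵍ z (i ∷ l) = z i ∙ Σᵍ z l

  -- The family z is independent modulo q, relative to small multiples of g, as far as relations with at
  -- most m terms on each side can tell.
  Generic : ∀ {i} {I : Set i} → DecidableEquality I → ℕ → ℕ → Carrier → (I → Carrier) → Set (i ⊔ ℓ)
  Generic {I = I} _≟_ m q g z = ∀ (l l′ : List I) s t → length l ≤ m → length l′ ≤ m → s ≤ m → t ≤ m →
    Σᵍ z l ∙ s · g ≈ Σᵍ z l′ ∙ t · g → ∀ i → q ∣ ∣ count _≟_ i l - count _≟_ i l′ ∣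

  private
    -- For the induction on the size of the family, a word is split into the multiplicity of the
    -- newest index and the word `preds` in the older ones.
    zeros : ∀ {n} → List (Fin (suc n)) → ℕ
    zeros []          = 0
    zeros (zero ∷ l)  = suc (zeros l)
    zeros (suc _ ∷ l) = zeros l

    preds : ∀ {n} → List (Fin (suc n)) → List (Fin n)
    preds []          = []
    preds (zero ∷ l)  = preds l
    preds (suc i ∷ l) = i ∷ preds l

    zeros≤length : ∀ {n} (l : List (Fin (suc n))) → zeros l ≤ length l
    zeros≤length []          = z≤n
    zeros≤length (zero ∷ l)  = s≤s (zeros≤length l)
    zeros≤length (suc _ ∷ l) = ℕₚ.m≤n⇒m≤1+n (zeros≤length l)

    preds≤length : ∀ {n} (l : List (Fin (suc n))) → length (preds l) ≤ length l
    preds≤length []          = z≤n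
    preds≤length (zero ∷ l)  = ℕₚ.m≤n⇒m≤1+n (preds≤length l)
    preds≤length (suc _ ∷ l) = s≤s (preds≤length l)

    count-zero : ∀ {n} (l : List (Fin (suc n))) → count Finₚ._≟_ zero l ≡ zeros l
    count-zero []          = ≡.refl
    count-zero (zero ∷ l)  = ≡.cong suc (count-zero l)
    count-zero (suc _ ∷ l) = count-zero l

    δ-suc : ∀ {n} (i j : Fin n) → δ Finₚ._≟_ (suc i) (suc j) ≡ δ Finₚ._≟_ i j
    δ-suc i j with i Finₚ.≟ j
    ... | yes _ = ≡.refl
    ... | no _  = ≡.refl

    count-suc : ∀ {n} (i : Fin n) l → count Finₚ._≟_ (suc i) l ≡ count Finₚ._≟_ i (preds l)
    count-suc i []          = ≡.refl
    count-suc i (zero ∷ l)  = count-suc i l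
    count-suc i (suc j ∷ l) = ≡.cong₂ _+_ (δ-suc i j) (count-suc i l)

    Σᵍ-split : ∀ {n} z₀ (z : Fin n → Carrier) l →
      Σᵍ (z₀ Vector.∷ z) l ≈ zeros l · z₀ ∙ Σᵍ z (preds l)
    Σᵍ-split z₀ z []          = sym (identityˡ ε)
    Σᵍ-split z₀ z (zero ∷ l)  = trans (∙-congˡ (Σᵍ-split z₀ z l)) (sym (assoc _ _ _))
    Σᵍ-split z₀ z (suc i ∷ l) = trans (∙-congˡ (Σᵍ-split z₀ z l)) (x∙yz≈y∙xz _ _ _)

  module _ (m q : ℕ) .{{_ : NonZero q}} (g : Carrier)
           (large : ¬ Covered (λ x → Lift ℓ (q ≤ m) → Torsion q x)) (small : SmallTorsionCovered q) where

    private
      spanList : ∀ {n} → (Fin n → Carrier) → List Carrier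
      spanList {n} z = cartesianProductWith (λ l s → Σᵍ z l ∙ s · g) (boundedLists (allFin n) m) (upTo (suc m))

      ∈-spanList : ∀ {n} (z : Fin n → Carrier) l s → length l ≤ m → s ≤ m → Σᵍ z l ∙ s · g ∈ᵍ spanList z
      ∈-spanList z l s len s≤m = ∈ₚ.∈-cartesianProductWith⁺ (≡.setoid _) (≡.setoid _) setoid
        (λ { ≡.refl ≡.refl → refl }) (∈-boundedLists ∈-allFin l len) (∈-upTo⁺ (s≤s s≤m))

      differences : List Carrier → List Carrier
      differences xs = cartesianProductWith (λ v u → v ∙ u ⁻¹) xs xs

      module _ {z₀ : Carrier} {xs : List Carrier} (tors : Lift ℓ (q ≤ m) → Torsion q z₀)
               (avoid : ∀ n → 0 < n → n < q → n · z₀ ∉ᵍ differences xs) where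

        -- If `e < q`, there is nothing to reduce. Otherwise `q ≤ e ≤ m`, and exactly then the
        -- torsion hypothesis says that `q · z₀` vanishes.
        ·-mod : ∀ e → e ≤ m → e · z₀ ≈ (e % q) · z₀
        ·-mod e e≤m with ℕₚ.<-≤-connex e q
        ... | inj₁ e<q = ·-congˡ (≡.sym (m<n⇒m%n≡m e<q))
        ... | inj₂ q≤e = begin
          e · z₀                            ≈⟨ ·-congˡ (m≡m%n+[m/n]*n e q) ⟩
          (e % q + e / q * q) · z₀          ≈⟨ ·-homo-+ z₀ (e % q) (e / q * q) ⟩
          (e % q) · z₀ ∙ (e / q * q) · z₀   ≈⟨ ∙-congˡ (·-assocˡ z₀ (e / q) q) ⟨
          (e % q) · z₀ ∙ (e / q) · (q · z₀) ≈⟨ ∙-congˡ (·-congʳ (e / q) (tors (lift (ℕₚ.≤-trans q≤e e≤m)))) ⟩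
          (e % q) · z₀ ∙ (e / q) · ε        ≈⟨ ∙-congˡ (·-zeroʳ (e / q)) ⟩
          (e % q) · z₀ ∙ ε                  ≈⟨ identityʳ _ ⟩
          (e % q) · z₀                      ∎

        -- Cancelling `b · z₀` leaves `e · z₀ ∙ u ≈ v` with `e = a ∸ b`. A nonzero residue of `e`
        -- modulo `q` would make a small multiple of `z₀` equal to the difference of `v` and `u`,
        -- which `z₀` avoids. So `q` divides `e`, and `e · z₀` vanishes.
        cancel-multiples : ∀ {a b u v} → u ∈ᵍ xs → v ∈ᵍ xs → b ≤ a → a ≤ m →
          a · z₀ ∙ u ≈ b · z₀ ∙ v → q ∣ a ∸ b × u ≈ v
        cancel-multiples {a} {b} {u} {v} u∈ v∈ b≤a a≤m eq = cases (e % q) ≡.refl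
          where
          e = a ∸ b
          ez₀∙u≈v : e · z₀ ∙ u ≈ v
          ez₀∙u≈v = ∙-cancelˡ (b · z₀) _ _ (begin
            b · z₀ ∙ (e · z₀ ∙ u) ≈⟨ assoc _ _ _ ⟨
            b · z₀ ∙ e · z₀ ∙ u   ≈⟨ ∙-congʳ (·-homo-+ z₀ b e) ⟨
            (b + e) · z₀ ∙ u      ≈⟨ ∙-congʳ (·-congˡ (ℕₚ.m+[n∸m]≡n b≤a)) ⟩
            a · z₀ ∙ u            ≈⟨ eq ⟩
            b · z₀ ∙ v            ∎)
          e≤m = ℕₚ.≤-trans (ℕₚ.m∸n≤m a b) a≤m
          cases : ∀ r → e % q ≡ r → q ∣ e × u ≈ v
          cases zero    e%q≡0 = m%n≡0⇒n∣m e q e%q≡0 , (begin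
            u               ≈⟨ identityˡ u ⟨
            0 · z₀ ∙ u      ≈⟨ ∙-congʳ (·-congˡ (≡.sym e%q≡0)) ⟩
            (e % q) · z₀ ∙ u ≈⟨ ∙-congʳ (·-mod e e≤m) ⟨
            e · z₀ ∙ u      ≈⟨ ez₀∙u≈v ⟩
            v               ∎)
          cases (suc r) e%q≡1+r = contradiction
            (∈ₚ.∈-resp-≈ setoid v∙u⁻¹≈
              (∈ₚ.∈-cartesianProductWith⁺ setoid setoid setoid (λ p q → ∙-cong p (⁻¹-cong q)) v∈ u∈))
            (avoid (e % q) (≡.subst (0 <_) (≡.sym e%q≡1+r) (s≤s z≤n)) (m%n<n e q))
            where
            v∙u⁻¹≈ : v ∙ u ⁻¹ ≈ (e % q) · z₀
            v∙u⁻¹≈ = begin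
              v ∙ u ⁻¹                ≈⟨ ∙-congʳ ez₀∙u≈v ⟨
              e · z₀ ∙ u ∙ u ⁻¹       ≈⟨ assoc _ _ _ ⟩
              e · z₀ ∙ (u ∙ u ⁻¹)     ≈⟨ ∙-congˡ (inverseʳ u) ⟩
              e · z₀ ∙ ε              ≈⟨ identityʳ _ ⟩
              e · z₀                  ≈⟨ ·-mod e e≤m ⟩
              (e % q) · z₀            ∎

    -- Elements are added one at a time. Those with a multiple `n · x`, `0 < n < q`, among the
    -- differences of the bounded span are finitely many because the smaller torsion is finite,
    -- while the candidates satisfying the torsion condition are infinitely many.
    generic-exists : ∀ n → ∃ λ (z : Fin n → Carrier) → Generic Finₚ._≟_ m q g z
    generic-exists zero = (λ ()) , λ _ _ _ _ _ _ _ _ _ ()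
    generic-exists (suc n) with z , gen ← generic-exists n
      with bad , bad∈ ← smallMultiples-covered q small (differences (spanList z))
      with z₀ , tors , z₀∉ ← fresh large bad = z₀ Vector.∷ z , gen′
      where
      split : ∀ l s → Σᵍ (z₀ Vector.∷ z) l ∙ s · g ≈ zeros l · z₀ ∙ (Σᵍ z (preds l) ∙ s · g)
      split l s = trans (∙-congʳ (Σᵍ-split z₀ z l)) (assoc _ _ _)

      -- Multiplicities are subtracted in ℕ, so the side with more copies of `z₀` is put on the left
      -- first; `gen′` recovers the other case by symmetry.
      ordered : ∀ l l′ s t → length l ≤ m → length l′ ≤ m → s ≤ m → t ≤ m → zeros l′ ≤ zeros l →
        Σᵍ (z₀ Vector.∷ z) l ∙ s · g ≈ Σᵍ (z₀ Vector.∷ z) l′ ∙ t · g →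
        ∀ i → q ∣ ∣ count Finₚ._≟_ i l - count Finₚ._≟_ i l′ ∣
      ordered l l′ s t l≤m l′≤m s≤m t≤m b≤a eq
        with q∣ , tails≈ ← cancel-multiples tors
               (λ n 0<n n<q nz₀∈ → z₀∉ (bad∈ (n , 0<n , n<q , nz₀∈)))
               (∈-spanList z (preds l) s (ℕₚ.≤-trans (preds≤length l) l≤m) s≤m)
               (∈-spanList z (preds l′) t (ℕₚ.≤-trans (preds≤length l′) l′≤m) t≤m)
               b≤a (ℕₚ.≤-trans (zeros≤length l) l≤m)
               (trans (sym (split l s)) (trans eq (split l′ t))) = λ where
        zero    → ≡.subst (q ∣_) (≡.sym (≡.trans (≡.cong₂ ∣_-_∣ (count-zero l) (count-zero l′))
                    (ℕₚ.m≤n⇒∣n-m∣≡n∸m b≤a))) q∣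
        (suc i) → ≡.subst (q ∣_) (≡.sym (≡.cong₂ ∣_-_∣ (count-suc i l) (count-suc i l′)))
                    (gen (preds l) (preds l′) s t (ℕₚ.≤-trans (preds≤length l) l≤m)
                      (ℕₚ.≤-trans (preds≤length l′) l′≤m) s≤m t≤m tails≈ i)

      gen′ : Generic Finₚ._≟_ m q g (z₀ Vector.∷ z)
      gen′ l l′ s t l≤m l′≤m s≤m t≤m eq i with ℕₚ.≤-total (zeros l′) (zeros l)
      ... | inj₁ b≤a = ordered l l′ s t l≤m l′≤m s≤m t≤m b≤a eq i
      ... | inj₂ a≤b = ≡.subst (q ∣_) (ℕₚ.∣-∣-comm (count Finₚ._≟_ i l′) (count Finₚ._≟_ i l))
                         (ordered l′ l t s l′≤m l≤m t≤m s≤m a≤b (sym eq) i)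

-- Kronecker deltas and final segments of indices.

δ-cong : ∀ {a b} {A : Set a} {B : Set b} (_≟₁_ : DecidableEquality A) (_≟₂_ : DecidableEquality B)
  {x y u v} → (x ≡ y → u ≡ v) → (u ≡ v → x ≡ y) → δ _≟₁_ x y ≡ δ _≟₂_ u v
δ-cong _≟₁_ _≟₂_ {x} {y} {u} {v} to from with x ≟₁ y | u ≟₂ v
... | yes _   | yes _   = ≡.refl
... | no _    | no _    = ≡.refl
... | yes x≡y | no u≢v  = contradiction (to x≡y) u≢v
... | no x≢y  | yes u≡v = contradiction (from u≡v) x≢y

above : ∀ {n} → Fin n → List (Fin n)
above zero    = map suc (allFin _)
above (suc t) = map suc (above t)

∈-above⁺ : ∀ {n} {t j : Fin n} → t Fin.< j → j ∈ above t
∈-above⁺ {t = zero}  {suc j} _         = ∈-map⁺ suc (∈-allFin j)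
∈-above⁺ {t = suc t} {suc j} (s≤s t<j) = ∈-map⁺ suc (∈-above⁺ t<j)

∈-above⁻ : ∀ {n} (t : Fin n) {j} → j ∈ above t → t Fin.< j
∈-above⁻ zero    j∈ with _ , _ , ≡.refl ← ∈-map⁻ suc j∈ = s≤s z≤n
∈-above⁻ (suc t) j∈ with _ , i∈ , ≡.refl ← ∈-map⁻ suc j∈ = s≤s (∈-above⁻ t i∈)

above-unique : ∀ {n} (t : Fin n) → Unique (above t)
above-unique zero    = Uniqueₚ.map⁺ Finₚ.suc-injective (Uniqueₚ.allFin⁺ _)
above-unique (suc t) = Uniqueₚ.map⁺ Finₚ.suc-injective (above-unique t)

-- Here `toℕ (opposite t)` is n - 1 - t; it becomes the upper entry of the binomial coefficients.
length-above : ∀ {n} (t : Fin n) → length (above t) ≡ toℕ (opposite t)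
length-above {suc n} zero =
  ≡.trans (length-map suc (allFin n)) (≡.trans (length-tabulate {n = n} _) (≡.sym (Finₚ.toℕ-fromℕ n)))
length-above (suc t)      =
  ≡.trans (length-map suc (above t)) (≡.trans (length-above t) (≡.sym (Finₚ.toℕ-inject₁ (opposite t))))

-- The graph, its atoms and its cliques.

module Graph (H R : ℕ) where

  -- The leaf `(t , s)` is copy `s` of type `t`. All copies of a type have the same neighbours, and
  -- having `R` of them lets a set of leaves contain a type with any multiplicity up to `R`.
  Leaf : Set
  Leaf = Fin H × Fin R

  Vertex : Set
  Vertex = Leaf ⊎ Fin H

  pattern leaf l = inj₁ l
  pattern core j = inj₂ j

  -- These index the generic family: z_v for a vertex and z_uv for an ordered pair of vertices.
  Label : Set
  Label = Vertex ⊎ Vertex × Vertex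

  Atom : Set
  Atom = Vertex ⊎ (Vertex × Vertex ⊎ Vertex × Vertex)

  -- These stand for z_v, z_uv and z_u + z_v − z_uv, where π = (u , v).
  pattern vertex v = inj₁ v
  pattern pair π   = inj₂ (inj₁ π)
  pattern copair π = inj₂ (inj₂ π)

  -- An atom together with the multiple of g to be added; only leaves have an optional one, namely g itself.
  Element : Set
  Element = Atom × Fin 3

  -- `(l , J)` encodes a clique made of one leaf and a set of cores, and with it a sum that exists
  -- because of the optional element at `l`.
  Index : Set
  Index = Leaf × List (Fin H)

  infix 4 _≟L_ _≟V_ _≟A_ _≟F_

  _≟F_ : DecidableEquality Leaf
  _≟F_ = ×ₚ.≡-dec Finₚ._≟_ Finₚ._≟_

  _≟V_ : DecidableEquality Vertex
  _≟V_ = ⊎ₚ.≡-dec _≟F_ Finₚ._≟_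

  _≟P_ : DecidableEquality (Vertex × Vertex)
  _≟P_ = ×ₚ.≡-dec _≟V_ _≟V_

  _≟L_ : DecidableEquality Label
  _≟L_ = ⊎ₚ.≡-dec _≟V_ _≟P_

  _≟A_ : DecidableEquality Atom
  _≟A_ = ⊎ₚ.≡-dec _≟V_ (⊎ₚ.≡-dec _≟P_ _≟P_)

  Adj : Vertex → Vertex → Set
  Adj (leaf _)       (leaf _)       = ⊥
  Adj (leaf (t , _)) (core j)       = t Fin.< j
  Adj (core j)       (leaf (t , _)) = t Fin.< j
  Adj (core i)       (core j)       = i ≢ j

  adj? : ∀ u v → Dec (Adj u v)
  adj? (leaf _)       (leaf _)       = no λ ()
  adj? (leaf (t , _)) (core j)       = t Finₚ.<? j
  adj? (core j)       (leaf (t , _)) = t Finₚ.<? j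
  adj? (core i)       (core j)       = ¬? (i Finₚ.≟ j)

  Adj-sym : ∀ {u v} → Adj u v → Adj v u
  Adj-sym {leaf _} {core _} t<j = t<j
  Adj-sym {core _} {leaf _} t<j = t<j
  Adj-sym {core _} {core _} i≢j = i≢j ∘ ≡.sym

  Adj-irrefl : ∀ {u v} → Adj u v → u ≢ v
  Adj-irrefl {core _} adj ≡.refl = adj ≡.refl

  NonAdjacent : Atom → Set
  NonAdjacent (vertex _)       = ⊤
  NonAdjacent (pair (u , v))   = ¬ Adj u v
  NonAdjacent (copair (u , v)) = ¬ Adj u v

  Valid : List Leaf → Element → Set
  Valid O (vertex (leaf l) , zero)          = ⊤
  Valid O (vertex (leaf l) , suc zero)      = l ∈ O
  Valid O (vertex (leaf l) , suc (suc _))   = ⊤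
  Valid O (vertex (core _) , zero)          = ⊤
  Valid O (vertex (core _) , suc _)         = ⊥
  Valid O (pair (u , v)    , _)             = ¬ Adj u v
  Valid O (copair (u , v)  , _)             = ¬ Adj u v

  valid? : ∀ O e → Dec (Valid O e)
  valid? O (vertex (leaf l) , zero)        = yes tt
  valid? O (vertex (leaf l) , suc zero)    = Dec∈._∈?_ _≟F_ l O
  valid? O (vertex (leaf l) , suc (suc _)) = yes tt
  valid? O (vertex (core _) , zero)        = yes tt
  valid? O (vertex (core _) , suc _)       = no λ ()
  valid? O (pair (u , v)    , _)           = ¬? (adj? u v)
  valid? O (copair (u , v)  , _)           = ¬? (adj? u v)

  Valid⇒NonAdjacent : ∀ {O} e → Valid O e → NonAdjacent (proj₁ e)
  Valid⇒NonAdjacent (vertex _ , _) _  = tt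
  Valid⇒NonAdjacent (pair _ , _)   na = na
  Valid⇒NonAdjacent (copair _ , _) na = na

  Valid-mono : ∀ {O} e → Valid [] e → Valid O e
  Valid-mono (vertex (leaf _) , zero)        _  = tt
  Valid-mono (vertex (leaf _) , suc (suc _)) _  = tt
  Valid-mono (vertex (core _) , zero)        _  = tt
  Valid-mono (pair _   , _)                  na = na
  Valid-mono (copair _ , _)                  na = na

  leaves : List Leaf
  leaves = cartesianProduct (allFin H) (allFin R)

  vertices : List Vertex
  vertices = map inj₁ leaves ++ map inj₂ (allFin H)

  pairs : List (Vertex × Vertex)
  pairs = cartesianProduct vertices vertices

  atoms : List Atom
  atoms = map inj₁ vertices ++ map inj₂ (map inj₁ pairs ++ map inj₂ pairs)

  elements : List Element
  elements = cartesianProduct atoms (allFin 3)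

  ∈-vertices : ∀ v → v ∈ vertices
  ∈-vertices (leaf (t , s)) = ∈-++⁺ˡ (∈-map⁺ inj₁ (∈-cartesianProduct⁺ (∈-allFin t) (∈-allFin s)))
  ∈-vertices (core j)       = ∈-++⁺ʳ (map inj₁ leaves) (∈-map⁺ inj₂ (∈-allFin j))

  ∈-pairs : ∀ π → π ∈ pairs
  ∈-pairs (u , v) = ∈-cartesianProduct⁺ (∈-vertices u) (∈-vertices v)

  ∈-elements : ∀ e → e ∈ elements
  ∈-elements (a , o) = ∈-cartesianProduct⁺ (atom a) (∈-allFin o)
    where
    atom : ∀ a → a ∈ atoms
    atom (vertex v) = ∈-++⁺ˡ (∈-map⁺ inj₁ (∈-vertices v))
    atom (pair π)   = ∈-++⁺ʳ (map inj₁ vertices) (∈-map⁺ inj₂ (∈-++⁺ˡ (∈-map⁺ inj₁ (∈-pairs π))))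
    atom (copair π) = ∈-++⁺ʳ (map inj₁ vertices) (∈-map⁺ inj₂ (∈-++⁺ʳ (map inj₁ pairs) (∈-map⁺ inj₂ (∈-pairs π))))

  -- An atom contributes the labels in `pos` minus those in `neg` to a linear combination.

  pos : List Atom → List Label
  pos []                    = []
  pos (vertex v ∷ as)       = inj₁ v ∷ pos as
  pos (pair π ∷ as)         = inj₂ π ∷ pos as
  pos (copair (u , v) ∷ as) = inj₁ u ∷ inj₁ v ∷ pos as

  neg : List Atom → List Label
  neg []              = []
  neg (vertex _ ∷ as) = neg as
  neg (pair _ ∷ as)   = neg as
  neg (copair π ∷ as) = inj₂ π ∷ neg as

  -- A copair has two positive labels, hence the factor two. This is one reason for requiring
  -- genericity up to length `H + H`.
  length-pos : ∀ as → length (pos as) ≤ length as + length as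
  length-pos [] = z≤n
  length-pos (a ∷ as) rewrite ℕₚ.+-suc (length as) (length as) with a
  ... | vertex _ = s≤s (ℕₚ.m≤n⇒m≤1+n (length-pos as))
  ... | pair _   = s≤s (ℕₚ.m≤n⇒m≤1+n (length-pos as))
  ... | copair _ = s≤s (s≤s (length-pos as))

  length-neg : ∀ as → length (neg as) ≤ length as
  length-neg []              = z≤n
  length-neg (vertex _ ∷ as) = ℕₚ.m≤n⇒m≤1+n (length-neg as)
  length-neg (pair _ ∷ as)   = ℕₚ.m≤n⇒m≤1+n (length-neg as)
  length-neg (copair _ ∷ as) = s≤s (length-neg as)

  -- The coefficient of z_v in the combination that the atom stands for; it is 2 for the copair of
  -- `(v , v)`.
  incidence : Vertex → Atom → ℕ
  incidence v (vertex u)       = δ _≟V_ v u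
  incidence v (pair _)         = 0
  incidence v (copair (u , w)) = δ _≟V_ v u + δ _≟V_ v w

  count-pos-pair : ∀ π as → count _≟L_ (inj₂ π) (pos as) ≡ count _≟A_ (pair π) as
  count-pos-pair π []              = ≡.refl
  count-pos-pair π (vertex _ ∷ as) = count-pos-pair π as
  count-pos-pair π (pair ρ ∷ as)   = ≡.cong₂ _+_
    (δ-cong _≟L_ _≟A_ {inj₂ π} {inj₂ ρ} (λ { ≡.refl → ≡.refl }) (λ { ≡.refl → ≡.refl })) (count-pos-pair π as)
  count-pos-pair π (copair _ ∷ as) = count-pos-pair π as

  count-neg-pair : ∀ π as → count _≟L_ (inj₂ π) (neg as) ≡ count _≟A_ (copair π) as
  count-neg-pair π []              = ≡.refl
  count-neg-pair π (vertex _ ∷ as) = count-neg-pair π as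
  count-neg-pair π (pair _ ∷ as)   = count-neg-pair π as
  count-neg-pair π (copair ρ ∷ as) = ≡.cong₂ _+_
    (δ-cong _≟L_ _≟A_ {inj₂ π} {inj₂ ρ} (λ { ≡.refl → ≡.refl }) (λ { ≡.refl → ≡.refl })) (count-neg-pair π as)

  private
    δ-inj₁ : ∀ u v → δ _≟L_ (inj₁ u) (inj₁ v) ≡ δ _≟V_ u v
    δ-inj₁ u v = δ-cong _≟L_ _≟V_ (λ { ≡.refl → ≡.refl }) (λ { ≡.refl → ≡.refl })

  count-pos-vertex : ∀ v as → count _≟L_ (inj₁ v) (pos as) ≡ Σ[ as ] (incidence v)
  count-pos-vertex v []              = ≡.refl
  count-pos-vertex v (vertex u ∷ as) = ≡.cong₂ _+_ (δ-inj₁ v u) (count-pos-vertex v as)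
  count-pos-vertex v (pair _ ∷ as)   = count-pos-vertex v as
  count-pos-vertex v (copair (u , w) ∷ as) = ≡.trans
    (≡.cong₂ _+_ (δ-inj₁ v u) (≡.cong₂ _+_ (δ-inj₁ v w) (count-pos-vertex v as)))
    (≡.sym (ℕₚ.+-assoc (δ _≟V_ v u) _ _))

  count-neg-vertex : ∀ v as → count _≟L_ (inj₁ v) (neg as) ≡ 0
  count-neg-vertex v []              = ≡.refl
  count-neg-vertex v (vertex _ ∷ as) = count-neg-vertex v as
  count-neg-vertex v (pair _ ∷ as)   = count-neg-vertex v as
  count-neg-vertex v (copair _ ∷ as) = count-neg-vertex v as

  count-++ : ∀ i (xs ys : List Label) → count _≟L_ i (xs ++ ys) ≡ count _≟L_ i xs + count _≟L_ i ys
  count-++ i []       ys = ≡.refl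
  count-++ i (x ∷ xs) ys = ≡.trans (≡.cong (λ s → δ _≟L_ i x + s) (count-++ i xs ys)) (≡.sym (ℕₚ.+-assoc (δ _≟L_ i x) _ _))

  count-inj₁-pair : ∀ π vs → count _≟L_ (inj₂ π) (map inj₁ vs) ≡ 0
  count-inj₁-pair π []       = ≡.refl
  count-inj₁-pair π (_ ∷ vs) = count-inj₁-pair π vs

  count-inj₁-vertex : ∀ v vs → count _≟L_ (inj₁ v) (map inj₁ vs) ≡ count _≟V_ v vs
  count-inj₁-vertex v []       = ≡.refl
  count-inj₁-vertex v (u ∷ vs) = ≡.cong₂ _+_ (δ-inj₁ v u) (count-inj₁-vertex v vs)

  -- A vertex whose coefficient is nonzero mod q is an atom itself or an end of some π for which both `pair π`
  -- and `copair π` occur. Charging the first end to `pair π` and the second to `copair π` makes distinct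
  -- vertices use distinct atoms.

  owner : Atom → Vertex
  owner (vertex v)       = v
  owner (pair (u , _))   = u
  owner (copair (_ , v)) = v

  Partner : List Atom → Atom → Set
  Partner as (vertex _) = ⊤
  Partner as (pair π)   = copair π ∈ as
  Partner as (copair π) = pair π ∈ as

  Represented : List Atom → Vertex → Set
  Represented as v = ∃ λ a → a ∈ as × owner a ≡ v × Partner as a

  -- If `v` had no representative, `vertex v` would be absent, and every copair at `v` that occurs
  -- would lack its pair, so that `pairs≡` makes its multiplicity divisible by `q`. The coefficient
  -- of `v` would then be 0 modulo `q`, although it is 1 and `q ≥ 2`.
  represented : ∀ {as q v} → 2 ≤ q →
    (∀ π → q ∣ ∣ count _≟A_ (pair π) as - count _≟A_ (copair π) as ∣) →
    q ∣ ∣ Σ[ as ] (incidence v) - 1 ∣ → ExcludedMiddle Level.zero → Represented as v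
  represented {as} {q} {v} 2≤q pairs≡ v≡1 em with em {Represented as v}
  ... | yes rep = rep
  ... | no ¬rep = contradiction (impossible _ q∣Σ v≡1) (ℕₚ.<⇒≱ 2≤q)
    where
    impossible : ∀ n → q ∣ n → q ∣ ∣ n - 1 ∣ → q ≤ 1
    impossible zero    _     q∣1 = ∣⇒≤ q∣1
    impossible (suc n) q∣1+n q∣n = ∣⇒≤ (∣m+n∣m⇒∣n {n = 1} (≡.subst (q ∣_) (ℕₚ.+-comm 1 n) q∣1+n)
      (≡.subst (q ∣_) (ℕₚ.∣-∣-identityʳ n) q∣n))
    q∣copair : ∀ π → ¬ (pair π ∈ as) → q ∣ count _≟A_ (copair π) as
    q∣copair π ∉as = ≡.subst (λ c → q ∣ ∣ c - count _≟A_ (copair π) as ∣) (count-∉ _≟A_ as ∉as) (pairs≡ π)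
    q∣count : ∀ a → ¬ (a ∈ as) → q ∣ count _≟A_ a as
    q∣count a a∉ = ≡.subst (q ∣_) (≡.sym (count-∉ _≟A_ as a∉)) (q ∣0)
    dec∈ = Dec∈._∈?_ _≟A_
    classes : ∀ a → incidence v a ≡ 0 ⊎ q ∣ count _≟A_ a as
    classes (vertex u) with v ≟V u
    ... | no _       = inj₁ ≡.refl
    ... | yes ≡.refl = inj₂ (q∣count (vertex v) λ v∈ → ¬rep (vertex v , v∈ , ≡.refl , tt))
    classes (pair _) = inj₁ ≡.refl
    classes (copair (u , w)) with v ≟V u | v ≟V w | dec∈ (copair (u , w)) as
    ... | no _       | no _       | _      = inj₁ ≡.refl
    ... | _          | _          | no ∉as = inj₂ (q∣count _ ∉as)
    ... | yes ≡.refl | _          | yes ∈as =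
      inj₂ (q∣copair _ λ p∈ → ¬rep (pair (u , w) , p∈ , ≡.refl , ∈as))
    ... | no _       | yes ≡.refl | yes ∈as =
      inj₂ (q∣copair _ λ p∈ → ¬rep (copair (u , w) , ∈as , ≡.refl , p∈))
    q∣Σ : q ∣ Σ[ as ] (incidence v)
    q∣Σ = ∣-Σ _≟A_ q (incidence v) as classes

  private
    representatives : ∀ {as} K → All (Represented as) K →
      ∃ λ rs → map owner rs ≡ K × All (λ r → r ∈ as × Partner as r) rs
    representatives []      []                                 = [] , ≡.refl , []
    representatives (_ ∷ K) ((r , r∈ , ≡.refl , partner) ∷ ps) with rs , ≡.refl , qs ← representatives K ps =
      r ∷ rs , ≡.refl , (r∈ , partner) ∷ qs

  -- The vertices of a clique are distinct, so their representatives are distinct atoms and, by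
  -- length, exhaust `as`. If one were a pair or a copair, its partner would be a representative
  -- too, and their owners, the two ends, would be adjacent, against `NonAdjacent`.
  represented⇒↭ : ∀ {as K} → length as ≡ length K → All NonAdjacent as → AllPairs Adj K →
    All (Represented as) K → as ↭ map vertex K
  represented⇒↭ {as} {K} len nonadj clique reps
    with rs , ≡.refl , rs∈ ← representatives K reps = ↭-trans as↭rs (↭-reflexive rs≡)
    where
    uniqueOwners : Unique (map owner rs)
    uniqueOwners = AllPairs.map Adj-irrefl clique
    as↭rs : as ↭ rs
    as↭rs = Unique-⊆-length⇒↭ (Uniqueₚ.map⁻ uniqueOwners) (λ r∈ → proj₁ (All.lookup rs∈ r∈))
      (ℕₚ.≤-reflexive (≡.trans len (length-map owner rs)))
    conflict : ∀ {a b} → a ∈ rs → b ∈ rs → a ≢ b → Adj (owner a) (owner b)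
    conflict {a} {b} a∈ b∈ a≢b with AllPairs-lookup (AllPairsₚ.map⁻ clique) a∈ b∈ a≢b
    ... | inj₁ adj = adj
    ... | inj₂ adj = Adj-sym {owner b} {owner a} adj
    isVertex : ∀ r → r ∈ rs → r ≡ vertex (owner r)
    isVertex (vertex _) _  = ≡.refl
    isVertex (pair π)   r∈ with r∈as , p∈as ← All.lookup rs∈ r∈ =
      contradiction (conflict r∈ (∈-resp-↭ as↭rs p∈as) λ ()) (All.lookup nonadj r∈as)
    isVertex (copair π) r∈ with r∈as , p∈as ← All.lookup rs∈ r∈ =
      contradiction (conflict (∈-resp-↭ as↭rs p∈as) r∈ λ ()) (All.lookup nonadj r∈as)
    allVertices : ∀ rs → (∀ r → r ∈ rs → r ≡ vertex (owner r)) → rs ≡ map vertex (map owner rs)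
    allVertices []       _ = ≡.refl
    allVertices (r ∷ rs) h = ≡.cong₂ _∷_ (h r (here ≡.refl)) (allVertices rs (λ r r∈ → h r (there r∈)))
    rs≡ = allVertices rs isVertex

  cliqueOf : Index → List Vertex
  cliqueOf (l , J) = leaf l ∷ map core J

  indices : List Leaf → ℕ → List Index
  indices O k = dprod O (λ l → sublists k (above (proj₁ l)))

  indices-unique : ∀ {O} k → Unique O → Unique (indices O k)
  indices-unique k uniq = dprod-unique _ uniq (λ {l} _ → sublists-unique k (above-unique (proj₁ l)))

  length-indices : ∀ O k → length (indices O k) ≡ Σ[ O ] (λ l → toℕ (opposite (proj₁ l)) C k)
  length-indices O k = ≡.trans (length-dprod O _) (go O)
    where
    go : ∀ O → Σ[ O ] (λ l → length (sublists k (above (proj₁ l)))) ≡ Σ[ O ] (λ l → toℕ (opposite (proj₁ l)) C k)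
    go []            = ≡.refl
    go ((t , s) ∷ O) = ≡.cong₂ _+_
      (≡.trans (length-sublists k (above t)) (≡.cong (_C k) (length-above t))) (go O)

  cliqueOf-clique : ∀ {O k i} → i ∈ indices O k → AllPairs Adj (cliqueOf i)
  cliqueOf-clique {O} {k} {(t , s) , J} i∈ with _ , J∈ ← ∈-dprod⁻ O _ i∈ =
    Allₚ.map⁺ (All.tabulate λ j∈ → ∈-above⁻ t (∈-sublists⇒⊆ k (above t) J∈ j∈))
    ∷ AllPairsₚ.map⁺ (∈-sublists⇒Unique k (above-unique t) J∈)

  length-cliqueOf : ∀ {O k i} → i ∈ indices O k → length (cliqueOf i) ≡ suc k
  length-cliqueOf {O} {k} {l , J} i∈ with _ , J∈ ← ∈-dprod⁻ O _ i∈ =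
    ≡.cong suc (≡.trans (length-map core J) (∈-sublists⇒length k _ J∈))

  -- The leaf enters with its optional `g`, so these elements are all available exactly when the
  -- leaf belongs to `O`.
  aliveElements : Index → List Element
  aliveElements (l , J) = (vertex (leaf l) , suc zero) ∷ map (λ j → vertex (core j) , zero) J

  aliveElements-atoms : ∀ i → map proj₁ (aliveElements i) ≡ map vertex (cliqueOf i)
  aliveElements-atoms (l , J) = ≡.cong (_ ∷_) (≡.trans (≡.sym (map-∘ J)) (map-∘ J))

  aliveElements-valid : ∀ {O k i} → i ∈ indices O k → All (Valid O) (aliveElements i)
  aliveElements-valid {O} {k} {l , J} i∈ with l∈ , _ ← ∈-dprod⁻ O _ i∈ =
    l∈ ∷ Allₚ.map⁺ (All.tabulate λ _ → tt)

  length-aliveElements : ∀ {O k i} → i ∈ indices O k → length (aliveElements i) ≡ suc k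
  length-aliveElements {O} {k} {l , J} i∈ with _ , J∈ ← ∈-dprod⁻ O _ i∈ =
    ≡.cong suc (≡.trans (length-map _ J) (∈-sublists⇒length k _ J∈))

  optional : ∀ {O} v o → Valid O (vertex v , o) → ¬ Valid [] (vertex v , o) →
    ∃ λ l → l ∈ O × v ≡ leaf l × o ≡ suc zero
  optional (leaf l) zero          _  ¬val = contradiction tt ¬val
  optional (leaf l) (suc zero)    l∈ _    = l , l∈ , ≡.refl , ≡.refl
  optional (leaf l) (suc (suc _)) _  ¬val = contradiction tt ¬val
  optional (core _) zero          _  ¬val = contradiction tt ¬val

  cores-of-leaf : ∀ {O l} (vs : List (Vertex × Fin 3)) → All (λ v → Valid O (vertex (proj₁ v) , proj₂ v)) vs →
    All (λ v → Adj (leaf l) (proj₁ v)) vs →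
    ∃ λ js → vs ≡ map (λ j → core j , zero) js × All (proj₁ l Fin.<_) js
  cores-of-leaf []                    _              _            = [] , ≡.refl , []
  cores-of-leaf ((leaf _ , _) ∷ _)    _              (() ∷ _)
  cores-of-leaf ((core _ , suc _) ∷ _) (() ∷ _)      _
  cores-of-leaf ((core j , zero) ∷ vs) (_ ∷ valid) (t<j ∷ adjs)
    with js , ≡.refl , t<js ← cores-of-leaf vs valid adjs = j ∷ js , ≡.refl , t<j ∷ t<js

  -- Generic families are built over `Fin n`, and an injection is enough to transport genericity to
  -- labels.
  encoding : Label ↣ Fin ((H * R + H) + (H * R + H) * (H * R + H))
  encoding = ↔⇒↣ (↔-sym Finₚ.+↔⊎) ↣-∘ (encodingV ⊎-↣ (↔⇒↣ (↔-sym Finₚ.*↔×) ↣-∘ (encodingV ×-↣ encodingV)))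
    where
    encodingV : Vertex ↣ Fin (H * R + H)
    encodingV = ↔⇒↣ (↔-sym Finₚ.+↔⊎) ↣-∘ (↔⇒↣ (↔-sym Finₚ.*↔×) ⊎-↣ ↣-id (Fin H))

-- The sets and their iterated sumsets.

module Construction {c ℓ : Level} (em : ExcludedMiddle (c ⊔ ℓ)) (G : AbelianGroup c ℓ) (H R : ℕ) where

  open AbelianGroup G
  open Sumsets G
  open Membership setoid using () renaming (_∈_ to _∈ᵍ_; _∉_ to _∉ᵍ_)
  open GenericElements em G
  open Graph H R
  open import Algebra.Properties.Group group using (∙-cancelˡ)
  open import Algebra.Properties.CommutativeSemigroup commutativeSemigroup
    using (interchange; x∙yz≈y∙xz; xy∙z≈xz∙y)
  open import Algebra.Properties.Monoid.Sum monoid using () renaming (sum to ∑)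
  open import Relation.Binary.Reasoning.Setoid setoid
  open DecSetoid decSetoid using () renaming (_≟_ to _≈?_)

  Generic-∘ : ∀ {n m q g} {z : Fin n → Carrier} (f : Label ↣ Fin n) →
    Generic Finₚ._≟_ m q g z → Generic _≟L_ m q g (z ∘ Injection.to f)
  Generic-∘ {m = m} {q} {g} {z} f gen l l′ s t l≤ l′≤ s≤ t≤ eq i = ≡.subst₂ (λ a b → q ∣ ∣ a - b ∣)
    (count-map l) (count-map l′)
    (gen (map to l) (map to l′) s t
      (≡.subst (_≤ m) (≡.sym (length-map to l)) l≤) (≡.subst (_≤ m) (≡.sym (length-map to l′)) l′≤) s≤ t≤
      (trans (∙-congʳ (Σᵍ-map l)) (trans eq (∙-congʳ (sym (Σᵍ-map l′))))) (to i))
    where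
    open Injection f using (to; injective)
    count-map : ∀ l → count Finₚ._≟_ (to i) (map to l) ≡ count _≟L_ i l
    count-map []      = ≡.refl
    count-map (j ∷ l) = ≡.cong₂ _+_ (δ-cong Finₚ._≟_ _≟L_ injective (≡.cong to)) (count-map l)
    Σᵍ-map : ∀ l → Σᵍ z (map to l) ≈ Σᵍ (z ∘ to) l
    Σᵍ-map []      = refl
    Σᵍ-map (j ∷ l) = ∙-congˡ (Σᵍ-map l)

  Σᵍ-++ : ∀ {i} {I : Set i} (f : I → Carrier) xs ys → Σᵍ f (xs ++ ys) ≈ Σᵍ f xs ∙ Σᵍ f ys
  Σᵍ-++ f []       ys = sym (identityˡ _)
  Σᵍ-++ f (x ∷ xs) ys = trans (∙-congˡ (Σᵍ-++ f xs ys)) (sym (assoc _ _ _))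

  Σᵍ-↭ : ∀ {i} {I : Set i} (f : I → Carrier) {xs ys} → xs ↭ ys → Σᵍ f xs ≈ Σᵍ f ys
  Σᵍ-↭ f _↭_.refl          = refl
  Σᵍ-↭ f (prep x p)    = ∙-congˡ (Σᵍ-↭ f p)
  Σᵍ-↭ f (swap x y p)  = trans (∙-congˡ (∙-congˡ (Σᵍ-↭ f p))) (x∙yz≈y∙xz _ _ _)
  Σᵍ-↭ f (_↭_.trans p₁ p₂) = trans (Σᵍ-↭ f p₁) (Σᵍ-↭ f p₂)

  module _ (z : Label → Carrier) (g : Carrier) where

    base : Atom → Carrier
    base (vertex v)       = z (inj₁ v)
    base (pair π)         = z (inj₂ π)
    base (copair (u , v)) = z (inj₁ u) ∙ z (inj₁ v) ∙ z (inj₂ (u , v)) ⁻¹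

    val : Element → Carrier
    val (a , o) = base a ∙ toℕ o · g

    offset : List Element → ℕ
    offset es = Σ[ es ] (toℕ ∘ proj₂)

    offset≤ : ∀ es → offset es ≤ length es + length es
    offset≤ [] = z≤n
    offset≤ ((a , o) ∷ es) rewrite ℕₚ.+-suc (length es) (length es) =
      ℕₚ.+-mono-≤ (ℕₚ.≤-pred (Finₚ.toℕ<n o)) (offset≤ es)

    Σᵍ-val : ∀ es → Σᵍ val es ≈ Σᵍ base (map proj₁ es) ∙ offset es · g
    Σᵍ-val []             = sym (identityˡ ε)
    Σᵍ-val ((a , o) ∷ es) = begin
      base a ∙ toℕ o · g ∙ Σᵍ val es                                  ≈⟨ ∙-congˡ (Σᵍ-val es) ⟩
      base a ∙ toℕ o · g ∙ (Σᵍ base (map proj₁ es) ∙ offset es · g)   ≈⟨ interchange _ _ _ _ ⟩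
      base a ∙ Σᵍ base (map proj₁ es) ∙ (toℕ o · g ∙ offset es · g)   ≈⟨ ∙-congˡ (·-homo-+ g (toℕ o) _) ⟨
      base a ∙ Σᵍ base (map proj₁ es) ∙ (toℕ o + offset es) · g       ∎

    -- The inverses are moved to the other side because `Generic` speaks of sums without inverses.
    Σᵍ-base : ∀ as → Σᵍ base as ∙ Σᵍ z (neg as) ≈ Σᵍ z (pos as)
    Σᵍ-base []              = identityˡ ε
    Σᵍ-base (vertex v ∷ as) = trans (assoc _ _ _) (∙-congˡ (Σᵍ-base as))
    Σᵍ-base (pair π ∷ as)   = trans (assoc _ _ _) (∙-congˡ (Σᵍ-base as))
    Σᵍ-base (copair (u , v) ∷ as) = begin
      x ∙ y ∙ p ⁻¹ ∙ Σᵍ base as ∙ (p ∙ Σᵍ z (neg as))    ≈⟨ interchange _ _ _ _ ⟩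
      x ∙ y ∙ p ⁻¹ ∙ p ∙ (Σᵍ base as ∙ Σᵍ z (neg as))    ≈⟨ ∙-cong cancel (Σᵍ-base as) ⟩
      x ∙ y ∙ Σᵍ z (pos as)                              ≈⟨ assoc _ _ _ ⟩
      x ∙ (y ∙ Σᵍ z (pos as))                            ∎
      where
      x = z (inj₁ u)
      y = z (inj₁ v)
      p = z (inj₂ (u , v))
      cancel : x ∙ y ∙ p ⁻¹ ∙ p ≈ x ∙ y
      cancel = trans (assoc _ _ _) (trans (∙-congˡ (inverseˡ p)) (identityʳ _))

    Σᵍ-vertices : ∀ vs → Σᵍ base (map vertex vs) ≈ Σᵍ z (map inj₁ vs)
    Σᵍ-vertices []       = refl
    Σᵍ-vertices (v ∷ vs) = ∙-congˡ (Σᵍ-vertices vs)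

    -- The sumset in terms of lists of elements, whose summands can be permuted and remember their
    -- atoms and offsets.
    Sum : List Leaf → ℕ → Pred Carrier ℓ
    Sum O h x = ∃ λ es → length es ≡ h × All (Valid O) es × x ≈ Σᵍ val es

    𝒜 : List Leaf → Pred Carrier (c ⊔ ℓ)
    𝒜 O = _∈ᵍ map val (filter (valid? O) elements)

    ∈-𝒜⁺ : ∀ {O} e → Valid O e → 𝒜 O (val e)
    ∈-𝒜⁺ {O} e valid = ∈ₚ.∈-map⁺ (≡.setoid _) setoid (λ { ≡.refl → refl })
      (∈-filter⁺ (valid? O) (∈-elements e) valid)

    ∈-𝒜⁻ : ∀ {O x} → 𝒜 O x → ∃ λ e → Valid O e × x ≈ val e
    ∈-𝒜⁻ {O} x∈ with e , e∈ , x≈ ← ∈ₚ.∈-map⁻ (≡.setoid _) setoid x∈ =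
      e , proj₂ (∈-filter⁻ (valid? O) {xs = elements} e∈) , x≈

    Sum-resp-≈ : ∀ {O h x y} → x ≈ y → Sum O h x → Sum O h y
    Sum-resp-≈ x≈y (es , len , valid , x≈) = es , len , valid , trans (sym x≈y) x≈

    Sum-∑ : ∀ {O} h (a : Vector Carrier h) → (∀ i → 𝒜 O (a i)) → Sum O h (∑ a)
    Sum-∑ zero    a a∈ = [] , ≡.refl , [] , refl
    Sum-∑ (suc h) a a∈ with e , valid , a≈ ← ∈-𝒜⁻ (a∈ zero)
      | es , len , valids , sum≈ ← Sum-∑ h (a ∘ suc) (a∈ ∘ suc) =
      e ∷ es , ≡.cong suc len , valid ∷ valids , ∙-cong a≈ sum≈

    fold⇒Sum : ∀ {O} h {x} → (h -fold 𝒜 O) x → Sum O h x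
    fold⇒Sum h (a , a∈ , x≈) = Sum-resp-≈ (sym x≈) (Sum-∑ h a a∈)

    Σᵍ-val-∑ : ∀ {O} es → All (Valid O) es →
      ∃ λ (a : Vector Carrier (length es)) → (∀ i → 𝒜 O (a i)) × Σᵍ val es ≈ ∑ a
    Σᵍ-val-∑ []       []               = (λ ()) , (λ ()) , refl
    Σᵍ-val-∑ (e ∷ es) (valid ∷ valids) with a , a∈ , sum≈ ← Σᵍ-val-∑ es valids =
      val e Vector.∷ a , (λ { zero → ∈-𝒜⁺ e valid ; (suc i) → a∈ i }) , ∙-congˡ sum≈

    Sum⇒fold : ∀ {O} h {x} → Sum O h x → (h -fold 𝒜 O) x
    Sum⇒fold h (es , ≡.refl , valid , x≈) with a , a∈ , sum≈ ← Σᵍ-val-∑ es valid = a , a∈ , trans x≈ sum≈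

    𝒜-finite : ∀ O → Finite (𝒜 O)
    𝒜-finite O = _ , dedup-hasCardinality (map val (filter (valid? O) elements)) (λ _ x∈ → x∈) (λ _ x∈ → x∈)

    sums : List Leaf → ℕ → List Carrier
    sums O h = map (Σᵍ val) (filter (λ es → (length es ℕₚ.≟ h) ×-dec all? (valid? O) es) (boundedLists elements h))

    ∈-sums⁺ : ∀ {O h x} → Sum O h x → x ∈ᵍ sums O h
    ∈-sums⁺ {O} {h} (es , len , valid , x≈) = ∈ₚ.∈-resp-≈ setoid (sym x≈)
      (∈ₚ.∈-map⁺ (≡.setoid _) setoid (λ { ≡.refl → refl })
        (∈-filter⁺ _ (∈-boundedLists ∈-elements es (ℕₚ.≤-reflexive len)) (len , valid)))

    ∈-sums⁻ : ∀ {O h x} → x ∈ᵍ sums O h → Sum O h x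
    ∈-sums⁻ {O} {h} x∈ with es , es∈ , x≈ ← ∈ₚ.∈-map⁻ (≡.setoid _) setoid x∈
      with _ , len , valid ← ∈-filter⁻ (λ es → (length es ℕₚ.≟ h) ×-dec all? (valid? O) es)
                               {xs = boundedLists elements h} es∈ =
      es , len , valid , x≈

    alive : Index → Carrier
    alive i = Σᵍ val (aliveElements i)

    alive-≈ : ∀ i → alive i ≈ Σᵍ z (map inj₁ (cliqueOf i)) ∙ 1 · g
    alive-≈ i@(l , J) = begin
      Σᵍ val (aliveElements i)
        ≈⟨ Σᵍ-val (aliveElements i) ⟩
      Σᵍ base (map proj₁ (aliveElements i)) ∙ offset (aliveElements i) · g
        ≡⟨ ≡.cong₂ (λ as o → Σᵍ base as ∙ o · g) (aliveElements-atoms i) (≡.cong suc (offset-cores J)) ⟩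
      Σᵍ base (map vertex (cliqueOf i)) ∙ 1 · g
        ≈⟨ ∙-congʳ (Σᵍ-vertices (cliqueOf i)) ⟩
      Σᵍ z (map inj₁ (cliqueOf i)) ∙ 1 · g ∎
      where
      offset-cores : ∀ J → offset (map (λ j → vertex (core j) , zero) J) ≡ 0
      offset-cores []      = ≡.refl
      offset-cores (j ∷ J) = offset-cores J

    alive-Sum : ∀ {O k i} → i ∈ indices O k → Sum O (suc k) (alive i)
    alive-Sum {O} {k} {i} i∈ =
      aliveElements i , length-aliveElements {O} {k} i∈ , aliveElements-valid {O} {k} i∈ , refl

    -- Absorption of the optional elements.

    IsPair : Element → Set
    IsPair (vertex _ , _) = ⊥
    IsPair (pair _   , _) = ⊤
    IsPair (copair _ , _) = ⊤

    private
      shift-offset : ∀ {x y} (o p o′ p′ : Fin 3) → toℕ o + toℕ p ≡ toℕ o′ + toℕ p′ →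
        (x ∙ toℕ o · g) ∙ (y ∙ toℕ p · g) ≈ (x ∙ toℕ o′ · g) ∙ (y ∙ toℕ p′ · g)
      shift-offset {x} {y} o p o′ p′ eq = begin
        (x ∙ toℕ o · g) ∙ (y ∙ toℕ p · g)     ≈⟨ interchange _ _ _ _ ⟩
        (x ∙ y) ∙ (toℕ o · g ∙ toℕ p · g)     ≈⟨ ∙-congˡ (·-homo-+ g (toℕ o) (toℕ p)) ⟨
        (x ∙ y) ∙ (toℕ o + toℕ p) · g         ≈⟨ ∙-congˡ (·-congˡ eq) ⟩
        (x ∙ y) ∙ (toℕ o′ + toℕ p′) · g       ≈⟨ ∙-congˡ (·-homo-+ g (toℕ o′) (toℕ p′)) ⟩
        (x ∙ y) ∙ (toℕ o′ · g ∙ toℕ p′ · g)   ≈⟨ interchange _ _ _ _ ⟩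
        (x ∙ toℕ o′ · g) ∙ (y ∙ toℕ p′ · g)   ∎

      IsPair-valid : ∀ {O O′ a} o o′ → IsPair (a , o) → Valid O (a , o) → IsPair (a , o′) × Valid O′ (a , o′)
      IsPair-valid {a = pair _}   _ _ _ na = tt , na
      IsPair-valid {a = copair _} _ _ _ na = tt , na

    AbsorbedBy : Element → Carrier → Set ℓ
    AbsorbedBy e x = ∃₂ λ e′ f → IsPair e′ × Valid [] e′ × Valid [] f × val e ∙ x ≈ val e′ ∙ val f

    -- Only a leaf with offset 1 has to change. The identities 0 + 1 = 1 + 0, 1 + 1 = 2 + 0 and 2 +
    -- 1 = 1 + 2 give it the offset 0 or 2, while the pair element stays within the offsets 0, 1, 2.
    absorb-element : ∀ {O} e f → IsPair e → Valid O e → Valid O f → AbsorbedBy e (val f)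
    absorb-element {O} (a , o) (b , p) isP va vb with valid? [] (b , p)
    ... | yes vb₀ = (a , o) , (b , p) , isP , proj₂ (IsPair-valid {O} o o isP va) , vb₀ , refl
    absorb-element (a , o) (pair _ , p)   isP va vb | no ¬vb₀ = contradiction vb ¬vb₀
    absorb-element (a , o) (copair _ , p) isP va vb | no ¬vb₀ = contradiction vb ¬vb₀
    absorb-element {O} (a , o) (vertex v , p) isP va vb | no ¬vb₀ with optional v p vb ¬vb₀
    ... | l , _ , ≡.refl , ≡.refl = lower-leaf o isP va
      where
      lower-leaf : ∀ o → IsPair (a , o) → Valid O (a , o) → AbsorbedBy (a , o) (val (vertex (leaf l) , suc zero))
      lower-leaf zero isP va with isP′ , va′ ← IsPair-valid {O} {[]} zero (suc zero) isP va =
        (a , suc zero) , (vertex (leaf l) , zero) , isP′ , va′ , tt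
        , shift-offset zero (suc zero) (suc zero) zero ≡.refl
      lower-leaf (suc zero) isP va with isP′ , va′ ← IsPair-valid {O} {[]} (suc zero) (suc (suc zero)) isP va =
        (a , suc (suc zero)) , (vertex (leaf l) , zero) , isP′ , va′ , tt
        , shift-offset (suc zero) (suc zero) (suc (suc zero)) zero ≡.refl
      lower-leaf (suc (suc zero)) isP va with isP′ , va′ ← IsPair-valid {O} {[]} (suc (suc zero)) (suc zero) isP va =
        (a , suc zero) , (vertex (leaf l) , suc (suc zero)) , isP′ , va′ , tt
        , shift-offset (suc (suc zero)) (suc zero) (suc zero) (suc (suc zero)) ≡.refl

    absorb : ∀ {O} e es → IsPair e → Valid O e → All (Valid O) es →
      ∃₂ λ e′ es′ → IsPair e′ × length es′ ≡ length es × All (Valid []) (e′ ∷ es′) ×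
        val e ∙ Σᵍ val es ≈ val e′ ∙ Σᵍ val es′
    absorb {O} e@(_ , o) [] isP ve [] = e , [] , isP , ≡.refl , proj₂ (IsPair-valid {O} o o isP ve) ∷ [] , refl
    absorb {O} e (f ∷ es) isP ve (vf ∷ ves)
      with e₁ , es₁ , isP₁ , len , ve₁ ∷ ves₁ , eq₁ ← absorb e es isP ve ves
      with e₂ , f₂ , isP₂ , ve₂ , vf₂ , eq₂ ← absorb-element e₁ f isP₁ (Valid-mono {O} e₁ ve₁) vf =
      e₂ , f₂ ∷ es₁ , isP₂ , ≡.cong suc len , ve₂ ∷ vf₂ ∷ ves₁ , (begin
        val e ∙ (val f ∙ Σᵍ val es)     ≈⟨ x∙yz≈y∙xz _ _ _ ⟩
        val f ∙ (val e ∙ Σᵍ val es)     ≈⟨ ∙-congˡ eq₁ ⟩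
        val f ∙ (val e₁ ∙ Σᵍ val es₁)   ≈⟨ x∙yz≈y∙xz _ _ _ ⟩
        val e₁ ∙ (val f ∙ Σᵍ val es₁)   ≈⟨ assoc _ _ _ ⟨
        val e₁ ∙ val f ∙ Σᵍ val es₁     ≈⟨ ∙-congʳ eq₂ ⟩
        val e₂ ∙ val f₂ ∙ Σᵍ val es₁    ≈⟨ assoc _ _ _ ⟩
        val e₂ ∙ (val f₂ ∙ Σᵍ val es₁)  ∎)

    vertexElement : Vertex × Fin 3 → Element
    vertexElement (v , o) = vertex v , o

    HasPair : List Leaf → List Element → Set ℓ
    HasPair O es = ∃₂ λ e es′ → IsPair e × suc (length es′) ≡ length es × All (Valid O) (e ∷ es′) ×
      Σᵍ val es ≈ Σᵍ val (e ∷ es′)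

    IsClique : List Element → Set
    IsClique es = ∃ λ vs → es ≡ map vertexElement vs × AllPairs (Adj on proj₁) vs

    -- A clique of vertices is grown from the end of the list. A new vertex not adjacent to one
    -- already there is replaced, together with it, by a pair and a copair that inherit their
    -- offsets; the sum is unchanged.
    pair-or-clique : ∀ {O} es → All (Valid O) es → HasPair O es ⊎ IsClique es
    pair-or-clique [] [] = inj₂ ([] , ≡.refl , [])
    pair-or-clique (e ∷ es) (ve ∷ ves) with pair-or-clique es ves
    ... | inj₁ (f , fs , isP , len , vf ∷ vfs , eq) =
      inj₁ (f , e ∷ fs , isP , ≡.cong suc len , vf ∷ ve ∷ vfs , trans (∙-congˡ eq) (x∙yz≈y∙xz _ _ _))
    pair-or-clique ((pair π , o) ∷ es)   (ve ∷ ves) | inj₂ _ =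
      inj₁ ((pair π , o) , es , tt , ≡.refl , ve ∷ ves , refl)
    pair-or-clique ((copair π , o) ∷ es) (ve ∷ ves) | inj₂ _ =
      inj₁ ((copair π , o) , es , tt , ≡.refl , ve ∷ ves , refl)
    pair-or-clique ((vertex v , o) ∷ es) (ve ∷ ves) | inj₂ (vs , ≡.refl , clique)
      with all? (adj? v ∘ proj₁) vs
    ... | yes adj = inj₂ ((v , o) ∷ vs , ≡.refl , adj ∷ clique)
    ... | no ¬adj with (w , p) , w∈ , ¬vw ← find (Allₚ.¬All⇒Any¬ (adj? v ∘ proj₁) vs ¬adj)
      with ws , vs↭ ← ∈⇒∷↭ w∈
      with _ ∷ vws ← All-resp-↭ (↭-map⁺ vertexElement vs↭) ves =
      inj₁ ((pair (v , w) , o) , (copair (v , w) , p) ∷ map vertexElement ws , tt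
        , ≡.sym (≡.cong suc (↭-length (↭-map⁺ vertexElement vs↭))) , ¬vw ∷ ¬vw ∷ vws , (begin
          x ∙ o·g ∙ Σᵍ val (map vertexElement vs)            ≈⟨ ∙-congˡ (Σᵍ-↭ val (↭-map⁺ vertexElement vs↭)) ⟩
          x ∙ o·g ∙ (y ∙ p·g ∙ S)                            ≈⟨ assoc _ _ _ ⟨
          (x ∙ o·g) ∙ (y ∙ p·g) ∙ S                          ≈⟨ ∙-congʳ (interchange _ _ _ _) ⟩
          (x ∙ y) ∙ (o·g ∙ p·g) ∙ S                          ≈⟨ ∙-congʳ (∙-congʳ replace) ⟩
          (r ∙ (x ∙ y ∙ r ⁻¹)) ∙ (o·g ∙ p·g) ∙ S             ≈⟨ ∙-congʳ (interchange _ _ _ _) ⟩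
          (r ∙ o·g) ∙ (x ∙ y ∙ r ⁻¹ ∙ p·g) ∙ S               ≈⟨ assoc _ _ _ ⟩
          r ∙ o·g ∙ (x ∙ y ∙ r ⁻¹ ∙ p·g ∙ S)                 ∎))
      where
      x = z (inj₁ v)
      y = z (inj₁ w)
      r = z (inj₂ (v , w))
      o·g = toℕ o · g
      p·g = toℕ p · g
      S = Σᵍ val (map vertexElement ws)
      replace : x ∙ y ≈ r ∙ (x ∙ y ∙ r ⁻¹)
      replace = sym (trans (comm _ _) (trans (assoc _ _ _) (trans (∙-congˡ (inverseˡ r)) (identityʳ _))))

    -- With a pair or copair present, all optional offsets are absorbed. Otherwise the summands form
    -- a clique; if an optional leaf occurs, the remaining summands are adjacent to it, hence cores
    -- above its type with offset 0, and sorting them yields the index.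
    Sum-base-or-alive : ∀ {O k x} → Sum O (suc k) x →
      Sum [] (suc k) x ⊎ ∃ λ i → i ∈ indices O k × x ≈ alive i
    Sum-base-or-alive {O} {k} (es , len , valid , x≈) with pair-or-clique es valid
    ... | inj₁ (e , es′ , isP , len′ , ve ∷ ves , eq)
      with e″ , es″ , _ , len″ , valid″ , eq″ ← absorb e es′ isP ve ves =
      inj₁ (e″ ∷ es″ , ≡.trans (≡.cong suc len″) (≡.trans len′ len) , valid″ , trans x≈ (trans eq eq″))
    ... | inj₂ (vs , ≡.refl , clique) with all? (valid? [] ∘ vertexElement) vs
    ...   | yes valid₀ = inj₁ (_ , len , Allₚ.map⁺ valid₀ , x≈)
    ...   | no ¬valid₀
      with (v , o) , v∈ , ¬v₀ ← find (Allₚ.¬All⇒Any¬ (valid? [] ∘ vertexElement) vs ¬valid₀)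
      with l , l∈ , ≡.refl , ≡.refl ← optional v o (All.lookup (Allₚ.map⁻ valid) v∈) ¬v₀
      with ws , vs↭ ← ∈⇒∷↭ v∈
      with adj ∷ clique′ ← AllPairs-↭ (λ {u} {w} → Adj-sym {proj₁ u} {proj₁ w}) clique vs↭
      with _ ∷ vws ← All-resp-↭ vs↭ (Allₚ.map⁻ valid)
      with js , ≡.refl , l<js ← cores-of-leaf {O} {l} ws vws adj
      with J , J∈ , js↭ ← ⊆-unique⇒sublist Finₚ._≟_ {above (proj₁ l)} {js} (AllPairsₚ.map⁻ clique′)
                            (λ j∈ → ∈-above⁺ (All.lookup l<js j∈)) =
      inj₂ ((l , J) , ∈-dprod⁺ _ l∈ (≡.subst (λ n → J ∈ sublists n (above (proj₁ l))) length-js J∈)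
        , trans x≈ (Σᵍ-↭ val (↭-trans (↭-map⁺ vertexElement vs↭) (prep _ elements↭))))
      where
      length-js : length js ≡ k
      length-js = ℕₚ.suc-injective (≡.trans (≡.sym (≡.trans (↭-length (↭-map⁺ vertexElement vs↭))
        (≡.cong suc (≡.trans (length-map vertexElement (map (λ j → core j , zero) js)) (length-map _ js))))) len)
      elements↭ : map vertexElement (map (λ j → core j , zero) js) ↭ map (λ j → vertex (core j) , zero) J
      elements↭ = ↭-trans (↭-reflexive (≡.sym (map-∘ js))) (↭-map⁺ _ js↭)

    -- Uniqueness of clique sums and the cardinalities.

    module _ {q : ℕ} (2≤q : 2 ≤ q) (g≉ε : ¬ g ≈ ε) (gen : Generic _≟L_ (H + H) q g z) where

      -- Genericity compares coefficients modulo `q`: for each π, `pair π` and `copair π` balance,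
      -- and every vertex of `K` has coefficient 1. So each vertex of `K` is represented, and there
      -- are only as many atoms as vertices.
      clique-sum-unique : ∀ es K t → length es ≡ length K → length K ≤ H → t ≤ H + H →
        All (NonAdjacent ∘ proj₁) es → AllPairs Adj K →
        Σᵍ val es ≈ Σᵍ z (map inj₁ K) ∙ t · g → map proj₁ es ↭ map vertex K
      clique-sum-unique es K t len K≤H t≤ nonadj clique eq =
        represented⇒↭ (≡.trans (length-map proj₁ es) len) (Allₚ.map⁺ nonadj) clique
          (All.tabulate λ {v} v∈ → represented 2≤q pairs≡ (vertex≡ v v∈) (lowerEM (c ⊔ ℓ) em))
        where
        as = map proj₁ es
        as≤H : length as ≤ H
        as≤H = ≡.subst (_≤ H) (≡.sym (≡.trans (length-map proj₁ es) len)) K≤H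
        es≤H : length es ≤ H
        es≤H = ≡.subst (_≤ H) (≡.sym len) K≤H
        rhs : List Label
        rhs = map inj₁ K ++ neg as
        length-rhs : length rhs ≤ H + H
        length-rhs = ≡.subst (_≤ H + H)
          (≡.sym (≡.trans (length-++ (map inj₁ K)) (≡.cong (_+ length (neg as)) (length-map inj₁ K))))
          (ℕₚ.+-mono-≤ K≤H (ℕₚ.≤-trans (length-neg as) as≤H))
        relation : Σᵍ z (pos as) ∙ offset es · g ≈ Σᵍ z rhs ∙ t · g
        relation = begin
          Σᵍ z (pos as) ∙ offset es · g                     ≈⟨ ∙-congʳ (Σᵍ-base as) ⟨
          Σᵍ base as ∙ Σᵍ z (neg as) ∙ offset es · g        ≈⟨ xy∙z≈xz∙y _ _ _ ⟩
          Σᵍ base as ∙ offset es · g ∙ Σᵍ z (neg as)        ≈⟨ ∙-congʳ (Σᵍ-val es) ⟨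
          Σᵍ val es ∙ Σᵍ z (neg as)                         ≈⟨ ∙-congʳ eq ⟩
          Σᵍ z (map inj₁ K) ∙ t · g ∙ Σᵍ z (neg as)         ≈⟨ xy∙z≈xz∙y _ _ _ ⟩
          Σᵍ z (map inj₁ K) ∙ Σᵍ z (neg as) ∙ t · g         ≈⟨ ∙-congʳ (Σᵍ-++ z (map inj₁ K) (neg as)) ⟨
          Σᵍ z rhs ∙ t · g                                  ∎
        congruence : ∀ i → q ∣ ∣ count _≟L_ i (pos as) - count _≟L_ i rhs ∣
        congruence = gen (pos as) rhs (offset es) t
          (ℕₚ.≤-trans (length-pos as) (ℕₚ.+-mono-≤ as≤H as≤H)) length-rhs
          (ℕₚ.≤-trans (offset≤ es) (ℕₚ.+-mono-≤ es≤H es≤H)) t≤ relation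
        pairs≡ : ∀ π → q ∣ ∣ count _≟A_ (pair π) as - count _≟A_ (copair π) as ∣
        pairs≡ π = ≡.subst₂ (λ a b → q ∣ ∣ a - b ∣) (count-pos-pair π as)
          (≡.trans (count-++ (inj₂ π) (map inj₁ K) (neg as))
            (≡.cong₂ _+_ (count-inj₁-pair π K) (count-neg-pair π as)))
          (congruence (inj₂ π))
        vertex≡ : ∀ v → v ∈ K → q ∣ ∣ Σ[ as ] (incidence v) - 1 ∣
        vertex≡ v v∈ = ≡.subst₂ (λ a b → q ∣ ∣ a - b ∣) (count-pos-vertex v as)
          (≡.trans (count-++ (inj₁ v) (map inj₁ K) (neg as))
            (≡.cong₂ _+_ (≡.trans (count-inj₁-vertex v K) (count-Unique _≟V_ (AllPairs.map Adj-irrefl clique) v∈))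
                         (count-neg-vertex v as)))
          (congruence (inj₁ v))

      module _ {k : ℕ} (k<H : k < H) where

        private
          1≤2H : 1 ≤ H + H
          1≤2H = ℕₚ.≤-trans (s≤s z≤n) (ℕₚ.≤-trans k<H (ℕₚ.m≤m+n H H))

        alive-atoms : ∀ {O O′ es i} → length es ≡ suc k → All (Valid O) es → i ∈ indices O′ k →
          Σᵍ val es ≈ alive i → map proj₁ es ↭ map vertex (cliqueOf i)
        alive-atoms {O} {O′} {es} {i} len valid i∈ eq = clique-sum-unique es (cliqueOf i) 1
          (≡.trans len (≡.sym (length-cliqueOf {O′} {k} i∈)))
          (≡.subst (_≤ H) (≡.sym (length-cliqueOf {O′} {k} i∈)) k<H) 1≤2H
          (All.map (λ {e} → Valid⇒NonAdjacent {O} e) valid) (cliqueOf-clique {O′} {k} i∈) (trans eq (alive-≈ i))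

        -- The value determines the atoms up to order. Among them there is one leaf, which gives
        -- `l`, and the cores give `J` because sublists of a duplicate-free list are determined by
        -- their entries.
        alive-injective : ∀ {O i i′} → i ∈ indices O k → i′ ∈ indices O k → alive i ≈ alive i′ → i ≡ i′
        alive-injective {O} {i@(l , J)} {i′@(l′ , J′)} i∈ i′∈ eq =
          same (↭-trans (↭-reflexive (≡.sym (aliveElements-atoms i)))
            (alive-atoms {O} {O} (length-aliveElements {O} {k} i∈) (aliveElements-valid {O} {k} i∈) i′∈ eq))
          where
          coreAtom : Fin H → Atom
          coreAtom j = vertex (core j)
          sameLeaf : ∀ J′ → vertex (leaf l) ∈ map vertex (map core J′) → ⊥
          sameLeaf (_ ∷ J′) (there l∈) = sameLeaf J′ l∈
          same : map vertex (cliqueOf i) ↭ map vertex (cliqueOf i′) → i ≡ i′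
          same p with ∈-resp-↭ p (here ≡.refl)
          ... | there l∈    = contradiction l∈ (sameLeaf J′)
          ... | here ≡.refl with js , eq′ , J↭js ← ↭-map-inv coreAtom
                                    (↭-trans (↭-reflexive (map-∘ J)) (drop-∷ p)) =
            ≡.cong (l ,_) (sublists-↭⇒≡ k (above-unique (proj₁ l))
              (proj₂ (∈-dprod⁻ O _ i∈)) (proj₂ (∈-dprod⁻ O _ i′∈))
              (↭-trans J↭js (↭-reflexive
                (map-injective (λ { ≡.refl → ≡.refl }) (≡.trans (≡.sym eq′) (≡.sym (map-∘ J′)))))))

        -- The atoms must be those of the clique. Without optional elements the cores have offset 0
        -- and the leaf has offset 0 or 2, so cancelling the generic part leaves `0 · g ≈ g` or
        -- `2 · g ≈ g`; either forces `g ≈ ε`.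
        alive-new : ∀ {O i} → i ∈ indices O k → ¬ Sum [] (suc k) (alive i)
        alive-new {O} {i@(l , J)} i∈ (es , len , valid , eq) = wrongOffset es valid p (begin
          offset es · g                        ≈⟨ ∙-cancelˡ S _ _ (begin
            S ∙ offset es · g                                 ≈⟨ ∙-congʳ (sym (trans (Σᵍ-↭ base p) (Σᵍ-vertices (cliqueOf i)))) ⟩
            Σᵍ base (map proj₁ es) ∙ offset es · g            ≈⟨ Σᵍ-val es ⟨
            Σᵍ val es                                         ≈⟨ eq ⟨
            alive i                                           ≈⟨ alive-≈ i ⟩
            S ∙ 1 · g                                         ∎) ⟩
          1 · g                                ≈⟨ identityʳ g ⟩
          g                                    ∎)
          where
          S = Σᵍ z (map inj₁ (cliqueOf i))
          p = alive-atoms {[]} {O} len valid i∈ (sym eq)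
          coreOffset : ∀ {es} J → All (Valid []) es → map proj₁ es ≡ map vertex (map core J) → offset es ≡ 0
          coreOffset {[]}                  []      _        _  = ≡.refl
          coreOffset {(_ , zero) ∷ es}     (j ∷ J) (_ ∷ vs) eq = coreOffset J vs (∷-injectiveʳ eq)
          coreOffset {(_ , suc _) ∷ es}    (j ∷ J) (v ∷ vs) eq with ∷-injectiveˡ eq
          coreOffset {(_ , suc _) ∷ es}    (j ∷ J) (() ∷ vs) eq | ≡.refl
          wrongOffset : ∀ es → All (Valid []) es → map proj₁ es ↭ map vertex (cliqueOf i) → ¬ offset es · g ≈ g
          wrongOffset es valid p offset≈ with es′ , eq′ , es↭ ← ↭-map-inv proj₁ p with es′ | eq′
          ... | (_ , o) ∷ fs | eq″ with All-resp-↭ es↭ valid | ∷-injective eq″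
          ...   | v ∷ vs | ≡.refl , eqs = final o v (trans (·-congˡ (≡.sym offset≡)) offset≈)
            where
            offset≡ : offset es ≡ toℕ o
            offset≡ = ≡.trans (sum-↭ (↭-map⁺ (toℕ ∘ proj₂) es↭))
              (≡.trans (≡.cong (λ s → toℕ o + s) (coreOffset J vs (≡.sym eqs))) (ℕₚ.+-identityʳ _))
              where open import Data.Nat.ListAction.Properties using (sum-↭)
            final : ∀ o → Valid [] (vertex (leaf l) , o) → ¬ toℕ o · g ≈ g
            final zero             _ eq = g≉ε (sym eq)
            final (suc (suc zero)) _ eq = g≉ε (trans (sym (identityʳ g)) (∙-cancelˡ g _ _ (trans eq (sym (identityʳ g)))))

        -- The first summand counts the sums that use no optional element, so it does not depend on
        -- `O`. The second counts the alive sums, which are new and pairwise distinct.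
        cardinality : ∀ {O} → Unique O → HasCardinality (suc k -fold 𝒜 O)
          (length (deduplicate _≈?_ (sums [] (suc k))) + Σ[ O ] (λ l → toℕ (opposite (proj₁ l)) C k))
        cardinality {O} uniqO = bs ++ as , unique , length≡ , λ x → mk⇔ to from
          where
          base-card = dedup-hasCardinality {P = Sum [] (suc k)} (sums [] (suc k)) (λ _ → ∈-sums⁺) (λ _ → ∈-sums⁻)
          bs = proj₁ base-card
          as = map alive (indices O k)
          module Base x = Equivalence (proj₂ (proj₂ (proj₂ base-card)) x)
          ∈as⁻ : ∀ {x} → x ∈ᵍ as → ∃ λ i → i ∈ indices O k × x ≈ alive i
          ∈as⁻ = ∈ₚ.∈-map⁻ (≡.setoid _) setoid
          unique = SetoidUniqueₚ.++⁺ setoid (proj₁ (proj₂ base-card))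
            (map-unique⁺ setoid (indices-unique k uniqO) (alive-injective {O}))
            λ { (x∈bs , x∈as) → let i , i∈ , x≈ = ∈as⁻ x∈as in
                  alive-new {O} i∈ (Sum-resp-≈ x≈ (Base.from _ x∈bs)) }
          length≡ = ≡.trans (length-++ bs) (≡.cong₂ _+_ ≡.refl
            (≡.trans (length-map alive (indices O k)) (length-indices O k)))
          to : ∀ {x} → (suc k -fold 𝒜 O) x → x ∈ᵍ bs ++ as
          to x∈ with Sum-base-or-alive {O} (fold⇒Sum (suc k) x∈)
          ... | inj₁ sum₀          = ∈ₚ.∈-++⁺ˡ setoid (Base.to _ sum₀)
          ... | inj₂ (i , i∈ , x≈) = ∈ₚ.∈-++⁺ʳ setoid bs
            (∈ₚ.∈-resp-≈ setoid (sym x≈) (∈ₚ.∈-map⁺ (≡.setoid _) setoid (λ { ≡.refl → refl }) i∈))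
          from : ∀ {x} → x ∈ᵍ bs ++ as → (suc k -fold 𝒜 O) x
          from x∈ with ∈ₚ.∈-++⁻ setoid bs x∈
          ... | inj₁ x∈bs with es , len , valid , x≈ ← Base.from _ x∈bs =
            Sum⇒fold (suc k) (es , len , All.map (λ {e} → Valid-mono {O} e) valid , x≈)
          ... | inj₂ x∈as with i , i∈ , x≈ ← ∈as⁻ x∈as =
            Sum⇒fold (suc k) (Sum-resp-≈ (sym x≈) (alive-Sum {O} i∈))

-- Choosing the leaf sets from the prescribed vectors.

-- The matrix is unitriangular once rows and columns are listed in decreasing order.
binomial-solve : ∀ n (t : Fin n → ℤ) → ∃ λ (c : Fin n → ℤ) → ∀ i →
  ∑ℤ (λ j → c j ℤ.* + (toℕ (opposite j) C toℕ (opposite i))) ≡ t i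
binomial-solve zero    t = (λ ()) , λ ()
binomial-solve (suc n) t = c , solves
  where
  w : Fin n → ℤ
  w i = t zero ℤ.* + (n C toℕ (opposite i))
  rest = binomial-solve n (λ i → t (suc i) - w i)
  c = t zero Vector.∷ proj₁ rest
  solves : ∀ i → ∑ℤ (λ j → c j ℤ.* + (toℕ (opposite j) C toℕ (opposite i))) ≡ t i
  -- In this row the lower entry is `n`. Only column zero has an upper entry as large, and there the
  -- coefficient is 1.
  solves zero rewrite Finₚ.toℕ-fromℕ n | nCn≡1 n = ≡.trans
    (≡.cong₂ ℤ._+_ (ℤₚ.*-identityʳ (t zero)) (≡.trans (sum-cong-≋ vanish) (sum-replicate-zero n)))
    (ℤₚ.+-identityʳ (t zero))
    where
    vanish : ∀ j → proj₁ rest j ℤ.* + (toℕ (opposite (suc j)) C n) ≡ + 0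
    vanish j rewrite Finₚ.toℕ-inject₁ (opposite j) | k>n⇒nCk≡0 (Finₚ.toℕ<n (opposite j)) =
      ℤₚ.*-zeroʳ (proj₁ rest j)
  solves (suc i) rewrite Finₚ.toℕ-fromℕ n | Finₚ.toℕ-inject₁ (opposite i) = ≡.trans
    (≡.cong (λ s → w i ℤ.+ s) (≡.trans (sum-cong-≋ reindex) (proj₂ rest i))) (cancel (w i) (t (suc i)))
    where
    reindex : ∀ j → proj₁ rest j ℤ.* + (toℕ (opposite (suc j)) C toℕ (opposite i)) ≡
                  proj₁ rest j ℤ.* + (toℕ (opposite j) C toℕ (opposite i))
    reindex j rewrite Finₚ.toℕ-inject₁ (opposite j) = ≡.refl
    cancel : ∀ x y → x ℤ.+ (y - x) ≡ y
    cancel = solve 2 (λ x y → x :+ (y :- x) := y) ≡.refl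
      where open ℤ-Solver

bounded : ∀ {n} (f : Fin n → ℕ) → ∃ λ b → ∀ i → f i ≤ b
bounded {zero}  f = 0 , λ ()
bounded {suc n} f with b , f≤b ← bounded (f ∘ suc) =
  f zero + b , λ { zero → ℕₚ.m≤m+n (f zero) b ; (suc i) → ℕₚ.m≤n⇒m≤o+n (f zero) (f≤b i) }

-- Adding `T` turns an integer coefficient into a possible number of leaves, and the upper bound
-- shows that `T + T` copies of each type suffice.
shift-to-ℕ : ∀ c T → ℤ.∣ c ∣ ≤ T → ∃ λ n → n ≤ T + T × + n ≡ c ℤ.+ + T
shift-to-ℕ (+ a)    T a≤T = a + T , ℕₚ.+-monoˡ-≤ T a≤T , ≡.refl
shift-to-ℕ -[1+ a ] T a<T = T ∸ suc a , ℕₚ.≤-trans (ℕₚ.m∸n≤m T (suc a)) (ℕₚ.m≤m+n T T) , ≡.sym (ℤₚ.⊖-≥ a<T)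

∑ℤ-*-distribˡ : ∀ {n} a (f : Fin n → ℤ) → ∑ℤ (λ j → a ℤ.* f j) ≡ a ℤ.* ∑ℤ f
∑ℤ-*-distribˡ {zero}  a f = ≡.sym (ℤₚ.*-zeroʳ a)
∑ℤ-*-distribˡ {suc n} a f = ≡.trans (≡.cong (λ s → a ℤ.* f zero ℤ.+ s) (∑ℤ-*-distribˡ a (f ∘ suc)))
  (≡.sym (ℤₚ.*-distribˡ-+ a (f zero) (∑ℤ (f ∘ suc))))

Σ-allFin : ∀ {n} (f : Fin n → ℕ) → + Σ[ allFin n ] f ≡ ∑ℤ (λ i → + f i)
Σ-allFin {n} f = go n id
  where
  go : ∀ m (g : Fin m → Fin n) → + Σ[ tabulate g ] f ≡ ∑ℤ (λ i → + f (g i))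
  go zero    g = ≡.refl
  go (suc m) g = ≡.trans (ℤₚ.pos-+ (f (g zero)) _) (≡.cong (λ s → + f (g zero) ℤ.+ s) (go m (g ∘ suc)))

module Leaves (H R : ℕ) (n : Fin H → ℕ) (n≤R : ∀ t → n t ≤ R) where

  slots : Fin H → List (Fin R)
  slots t = take (n t) (allFin R)

  leafList : List (Fin H × Fin R)
  leafList = dprod (allFin H) slots

  leafList-unique : Unique leafList
  leafList-unique = dprod-unique slots (Uniqueₚ.allFin⁺ H) λ {t} _ → Uniqueₚ.take⁺ (n t) (Uniqueₚ.allFin⁺ R)

  Σ-leafList : ∀ (φ : Fin H → ℕ) → + Σ[ leafList ] (φ ∘ proj₁) ≡ ∑ℤ (λ t → + n t ℤ.* + φ t)
  Σ-leafList φ = ≡.trans (≡.cong +_ (Σ-dprod (allFin H) slots φ)) (≡.trans (Σ-allFin {H} _)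
    (sum-cong-≋ λ t → ≡.trans (≡.cong (λ l → + (l * φ t)) (length-slots t)) (ℤₚ.pos-* (n t) (φ t))))
    where
    length-slots : ∀ t → length (slots t) ≡ n t
    length-slots t = ≡.trans (length-take (n t) (allFin R))
      (≡.trans (≡.cong (n t ⊓_) (length-tabulate {n = R} id)) (ℕₚ.m≤n⇒m⊓n≡m (n≤R t)))

-- Realising the prescribed vectors up to constants.

corollary1p5 : ∀ {c ℓ} → ExcludedMiddle (c ⊔ ℓ) →
    (G : AbelianGroup c ℓ) → let open Sumsets G in
    Infinite →
    (d H : ℕ) → .{{_ : NonZero d}} → .{{_ : NonZero H}} →
    (m : Fin H → Vector ℤ d) →
    ∃ λ (A : Fin d → Pred (AbelianGroup.Carrier G) (c ⊔ ℓ)) →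
    (∀ i → Finite (A i)) ×
    (∀ (k : Fin H) → ∃ λ (n : Fin d → ℕ) →
    (∀ i → HasCardinality (suc (toℕ k) -fold A i) (n i)) ×
    IsConstant (λ i → + n i - m k i))
corollary1p5 {c} {ℓ} em G inf d H m = family (genericModulus inf (H + H) 1≤2H) nontrivial
  where
  open AbelianGroup G using (_≈_; ε; sym)
  open Sumsets G
  open GenericElements em G

  1≤2H : 1 ≤ H + H
  1≤2H = ℕₚ.≤-trans (>-nonZero⁻¹ H) (ℕₚ.m≤m+n H H)

  nontrivial = fresh (infinite⇒¬covered inf) (ε ∷ [])

  -- `binomial-solve` has `opposite` in its lower entries, so the targets are passed to it in
  -- reverse order.
  coefficients : Fin d → Fin H → ℤ
  coefficients i = proj₁ (binomial-solve H (λ u → m (opposite u) i))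

  coefficients-solve : ∀ i k → ∑ℤ (λ t → coefficients i t ℤ.* + (toℕ (opposite t) C toℕ k)) ≡ m k i
  coefficients-solve i k = ≡.subst
    (λ u → ∑ℤ (λ t → coefficients i t ℤ.* + (toℕ (opposite t) C toℕ u)) ≡ m u i)
    (Finₚ.opposite-involutive k) (proj₂ (binomial-solve H (λ u → m (opposite u) i)) (opposite k))

  -- One `T` serves all `i`: the shift must be the same for every set, since its effect has to end
  -- up in the constant.
  bounds : ∃ λ T → ∀ i → proj₁ (bounded (λ t → ℤ.∣ coefficients i t ∣)) ≤ T
  bounds = bounded _

  T : ℕ
  T = proj₁ bounds

  shifted : ∀ i t → ∃ λ n → n ≤ T + T × + n ≡ coefficients i t ℤ.+ + T
  shifted i t = shift-to-ℕ (coefficients i t) T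
    (ℕₚ.≤-trans (proj₂ (bounded (λ t → ℤ.∣ coefficients i t ∣)) t) (proj₂ bounds i))

  module L i = Leaves H (T + T) (λ t → proj₁ (shifted i t)) (λ t → proj₁ (proj₂ (shifted i t)))
  open Construction em G H (T + T)
  open Graph H (T + T)

  Σ-leaves : ∀ i k → + Σ[ L.leafList i ] (λ l → toℕ (opposite (proj₁ l)) C toℕ k) ≡
    m k i ℤ.+ + T ℤ.* ∑ℤ (λ (t : Fin H) → + (toℕ (opposite t) C toℕ k))
  Σ-leaves i k = begin
    + Σ[ L.leafList i ] (λ l → toℕ (opposite (proj₁ l)) C toℕ k)
      ≡⟨ L.Σ-leafList i (λ t → toℕ (opposite t) C toℕ k) ⟩
    ∑ℤ (λ t → + proj₁ (shifted i t) ℤ.* w t)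
      ≡⟨ sum-cong-≋ (λ t → ≡.trans (≡.cong (ℤ._* w t) (proj₂ (proj₂ (shifted i t))))
                               (ℤₚ.*-distribʳ-+ (w t) (coefficients i t) (+ T))) ⟩
    ∑ℤ (λ t → coefficients i t ℤ.* w t ℤ.+ + T ℤ.* w t)
      ≡⟨ ∑-distrib-+ (λ t → coefficients i t ℤ.* w t) (λ t → + T ℤ.* w t) ⟩
    ∑ℤ (λ t → coefficients i t ℤ.* w t) ℤ.+ ∑ℤ (λ t → + T ℤ.* w t)
      ≡⟨ ≡.cong₂ ℤ._+_ (coefficients-solve i k) (∑ℤ-*-distribˡ (+ T) w) ⟩
    m k i ℤ.+ + T ℤ.* ∑ℤ w ∎
    where
    open ≡.≡-Reasoning
    w : Fin H → ℤ
    w t = + (toℕ (opposite t) C toℕ k)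

  family : _ → _ → _
  family (q , 2≤q , large , small) (g , _ , g∉)
    with z , gen ← generic-exists (H + H) q {{>-nonZero (ℕₚ.≤-trans (s≤s z≤n) 2≤q)}} g large small _ =
    (λ i → 𝒜 z′ g (L.leafList i)) , (λ i → 𝒜-finite z′ g (L.leafList i)) ,
    λ k → _ , (λ i → cardinality z′ g 2≤q (λ g≈ε → g∉ (here g≈ε)) (Generic-∘ encoding gen)
                       (Finₚ.toℕ<n k) (L.leafList-unique i)) ,
          λ i j → ≡.trans (difference _ i k) (≡.sym (difference _ j k))
    where
    z′ = z ∘ Injection.to encoding
    -- Here `b` is the number of sums without optional elements, common to all the sets because they
    -- share `z′` and `g`. The right-hand side does not involve `i`, which is the required
    -- constancy.
    difference : ∀ b i k →
      + (b + Σ[ L.leafList i ] (λ l → toℕ (opposite (proj₁ l)) C toℕ k)) - m k i ≡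
      + b ℤ.+ + T ℤ.* ∑ℤ (λ (t : Fin H) → + (toℕ (opposite t) C toℕ k))
    difference b i k = ≡.trans
      (≡.cong (λ s → s - m k i) (≡.trans (ℤₚ.pos-+ b _) (≡.cong (λ s → + b ℤ.+ s) (Σ-leaves i k))))
      (cancel (+ b) (m k i) _)
      where
      cancel : ∀ x y s → x ℤ.+ (y ℤ.+ s) - y ≡ x ℤ.+ s
      cancel = solve 3 (λ x y s → x :+ (y :+ s) :- y := x :+ s) ≡.refl
        where open ℤ-Solver
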